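{- Let $q_1,\ldots,q_k$ be positive rational numbers. Then there exists a simple planar graph $G=(V,E)$ and an edge $e\in E$ such that \[ \frac{\tau(G-e)}{\tau(G/e)}\ =\ q_1+\ldots+q_k \] and \[ |E|\ =\ 4\big(\mathrm{S}(q_1)+\ldots+\mathrm{S}(q_k)\big)+1. \]
   Context: For a graph $G$ without loops, $\tau(G)$ denotes the number of spanning trees. For an edge $e$, $G-e$ is the graph obtained by deleting $e$, and $G/e$ is the graph obtained by contracting $e$ and removing all resulting loops (multiple edges kept). A simple graph has no loops and no multiple edges. For integers $a_0\ge 0$ and $a_1,\ldots,a_\ell\ge 1$, the continued fraction $[a_0;a_1,\ldots,a_\ell]$ is $a_0+\cfrac{1}{a_1+\cfrac{1}{\ddots+\frac{1}{a_\ell}}}$. Every positive rational $q$ has such a representation, and for $q=[a_0;a_1,\ldots,a_\ell]$ one defines $\mathrm{S}(q):=a_0+a_1+\ldots+a_\ell$; this is independent of the choice among the two representations (since $[a_0;a_1,\ldots,a_\ell,1]=[a_0;a_1,\ldots,a_\ell+1]$). -}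

module Defs where

open import Data.Nat as ℕ using (ℕ; zero; suc; _≤_)
open import Data.Integer as ℤ using (ℤ; +_)
open import Data.Rational as ℚ using (ℚ; 0ℚ; 1ℚ)
open import Data.Fin as Fin using (Fin; punchOut)
open import Data.Fin.Properties using (_≟_)
open import Data.Fin.Subset as Sub using (Subset; outside)
open import Data.Vec as Vec using (Vec; _[_]≔_)
open import Data.List as List using (List; []; _∷_; length; lookup; removeAt; filter; map)
open import Data.List.Relation.Unary.All as LAll using ()
open import Data.Nat.ListAction as ListAction using ()
open import Data.List.Relation.Unary.Unique.Propositional using (Unique)
open import Data.List.Membership.Propositional as LMem using ()
open import Data.Product using (Σ; Σ-syntax; ∃; ∃-syntax; _×_; _,_; proj₁; proj₂)
open import Data.Product as Prod using ()
open import Data.Sum using (_⊎_)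
open import Relation.Nullary using (¬_; ¬?)
open import Relation.Binary.PropositionalEquality using (_≡_; _≢_; refl; sym)
open import Function.Bundles using (_⇔_)

-- Finite multigraphs without a fixed edge set type:
-- vertices are Fin n, edges are a list of (ordered) endpoint pairs.
-- Multiple edges = repeated pairs; loops = pairs (u , u).

Graph : ℕ → Set
Graph n = List (Fin n × Fin n)

Edge : ∀ {n} → Graph n → Set
Edge G = Fin (length G)

src tgt : ∀ {n} (G : Graph n) → Edge G → Fin n
src G e = proj₁ (lookup G e)
tgt G e = proj₂ (lookup G e)

Loopless : ∀ {n} → Graph n → Set
Loopless G = ∀ e → src G e ≢ tgt G e

Simple : ∀ {n} → Graph n → Set
Simple G = Loopless G ×
  (∀ e f → e ≢ f →
     ¬ ((src G e ≡ src G f × tgt G e ≡ tgt G f) ⊎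
        (src G e ≡ tgt G f × tgt G e ≡ src G f)))

delete : ∀ {n} (G : Graph n) → Edge G → Graph n
delete G e = removeAt G e

merge : ∀ {k} (u v : Fin (suc k)) → u ≢ v → Fin (suc k) → Fin k
merge u v u≢v w with w ≟ v
... | Relation.Nullary.yes _ = punchOut {i = v} {j = u} (λ eq → u≢v (sym eq))
... | Relation.Nullary.no w≢v = punchOut {i = v} {j = w} (λ eq → w≢v (sym eq))

contract : ∀ {k} (G : Graph (suc k)) (e : Edge G) → src G e ≢ tgt G e → Graph k
contract G e ne =
  filter (λ p → ¬? (proj₁ p ≟ proj₂ p))
         (map (Prod.map (merge (src G e) (tgt G e) ne) (merge (src G e) (tgt G e) ne)) G)

-- Spanning trees: edge subsets T (as Subset (length G)) such that the
-- spanning subgraph (all vertices, edges T) is a tree, i.e. connected and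
-- minimally connected (every edge of T is a bridge of T).

data Reach {n} (G : Graph n) (T : Subset (length G)) : Fin n → Fin n → Set where
  here : ∀ {u} → Reach G T u u
  step : ∀ {u w v} (i : Edge G) → i Sub.∈ T →
         (lookup G i ≡ (u , w) ⊎ lookup G i ≡ (w , u)) →
         Reach G T w v → Reach G T u v

Connected : ∀ {n} (G : Graph n) → Subset (length G) → Set
Connected {n} G T = ∀ (u v : Fin n) → Reach G T u v

SpanningTree : ∀ {n} (G : Graph n) → Subset (length G) → Set
SpanningTree G T =
  Connected G T ×
  (∀ i → i Sub.∈ T → ¬ Reach G (T [ i ]≔ outside) (src G i) (tgt G i))

NumSpanningTrees : ∀ {n} (G : Graph n) → ℕ → Set
NumSpanningTrees G t =
  Σ[ L ∈ List (Subset (length G)) ]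
    Unique L × length L ≡ t × (∀ T → (T LMem.∈ L) ⇔ SpanningTree G T)

-- Planarity: existence of a plane straight-line drawing with rational
-- coordinates.

Point : Set
Point = ℚ × ℚ

OnSegment : Point → Point → Point → Set
OnSegment x p q = Σ[ t ∈ ℚ ] (0ℚ ℚ.≤ t × t ℚ.≤ 1ℚ ×
  proj₁ x ≡ proj₁ p ℚ.+ t ℚ.* (proj₁ q ℚ.- proj₁ p) ×
  proj₂ x ≡ proj₂ p ℚ.+ t ℚ.* (proj₂ q ℚ.- proj₂ p))

IsEndpoint : ∀ {n} (G : Graph n) → Fin n → Edge G → Set
IsEndpoint G a e = a ≡ src G e ⊎ a ≡ tgt G e

PlaneDrawing : ∀ {n} (G : Graph n) → (Fin n → Point) → Set
PlaneDrawing {n} G pos =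
  (∀ a b → pos a ≡ pos b → a ≡ b) ×
  (∀ a e → OnSegment (pos a) (pos (src G e)) (pos (tgt G e)) → IsEndpoint G a e) ×
  (∀ e f → e ≢ f → ∀ x →
     OnSegment x (pos (src G e)) (pos (tgt G e)) →
     OnSegment x (pos (src G f)) (pos (tgt G f)) →
     Σ[ a ∈ Fin n ] (IsEndpoint G a e × IsEndpoint G a f × x ≡ pos a))

Planar : ∀ {n} → Graph n → Set
Planar {n} G = Σ[ pos ∈ (Fin n → Point) ] PlaneDrawing G pos

cfNumDen : ℕ → List ℕ → ℕ × ℕ
cfNumDen a [] = a , 1
cfNumDen a (b ∷ bs) with cfNumDen b bs
... | p , r = a ℕ.* p ℕ.+ r , p

IsCF : ℚ → ℕ × List ℕ → Set
IsCF q (a₀ , as) =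
  LAll.All (λ a → 1 ≤ a) as ×
  ℚ.↥ q ℤ.* + proj₂ (cfNumDen a₀ as) ≡ + proj₁ (cfNumDen a₀ as) ℤ.* ℚ.↧ q

cfSum : ℕ × List ℕ → ℕ
cfSum (a₀ , as) = a₀ ℕ.+ ListAction.sum as

sumℚ : ∀ {k} → Vec ℚ k → ℚ
sumℚ = Vec.foldr _ ℚ._+_ 0ℚ

sumℕ : ∀ {k} → Vec ℕ k → ℕ
sumℕ = Vec.foldr _ ℕ._+_ 0

{-# OPTIONS --safe #-}
module Submission where

-- τ(G - e) / τ(G / e) is the effective conductance between the ends of e in G - e with
-- unit conductances. A four-cycle between opposite corners has conductance 1 and leaves
-- the corners non-adjacent, so a series-parallel network built from S(q) four-cycles
-- along the Euclidean algorithm is simple with 4 S(q) edges and conductance q; putting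
-- such networks in parallel adds the qᵢ. Trees are counted by deletion-contraction.
-- For planarity, vertices are placed one by one at pairwise distinct abscissae, each new
-- vertex so high that its edges to two vertices visible from above avoid all older edges.

open import Defs

-- The four-cycle arises as two paths of length two in parallel. A single edge between the terminals
-- would be doubled by `e` or by the next parallel branch, and one path of length two has
-- conductance only 1/2. Hence the factor 4; the extra 1 in the edge count is `e` itself.
--
-- Actual contraction would change the vertex type at every step of a recursion. It is kept formal
-- instead: a list `C` of contracted edges accompanies the graph, and only the connectivity of `C`
-- matters. A network then acts on its surroundings through two numbers, `trees` and `forests`, and
-- counting is linear in the two states "terminals contracted" and "terminals not contracted".
--
-- For the drawing, shrinking finished pieces into place would need metric control over whole
-- networks. Building upwards needs one invariant: drawing a network may hide vertices strictly
-- between its terminals in abscissa, but never the terminals, so the next branch still reaches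
-- them.

module Counting where

  open import Data.Bool using (true; false)
  open import Data.Nat using (ℕ; zero; suc; _+_; _*_)
  open import Data.Nat.Tactic.RingSolver using (solve-∀)
  open import Data.Fin using (Fin; zero; suc)
  open import Data.Fin.Subset as Sub using (Subset; inside; outside)
  open import Data.Vec as Vec using (Vec; []; _∷_; _[_]≔_; here; there)
  open import Data.Vec.Properties using (∷-injectiveʳ; cast-is-id)
  open import Data.List as List using (List; []; _∷_; _++_; length; map)
  open import Data.List.Properties using (length-map; length-++; map-++; map-∘; map-id)
  open import Data.List.Membership.Propositional using (_∈_)
  open import Data.List.Membership.Propositional.Properties using (∈-map⁺; ∈-map⁻; ∈-++⁺ˡ; ∈-++⁺ʳ; ∈-++⁻)
  open import Data.List.Relation.Unary.Any using (here; there)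
  open import Data.List.Relation.Unary.All using ([]; _∷_)
  open import Data.List.Relation.Unary.AllPairs using ([]; _∷_)
  open import Data.List.Relation.Unary.Unique.Propositional using (Unique)
  import Data.List.Relation.Unary.Unique.Propositional.Properties as Uniqueₚ
  open import Data.Product as Prod using (Σ-syntax; ∃; _×_; proj₁; proj₂; _,_)
  open import Data.Sum as Sum using (_⊎_; inj₁; inj₂)
  open import Data.Empty using (⊥-elim)
  open import Data.Unit using (⊤; tt)
  open import Relation.Nullary using (¬_)
  open import Relation.Binary.PropositionalEquality using (_≡_; _≢_; refl; sym; trans; cong; cong₂; subst; subst₂)
  open import Relation.Binary.Construct.Closure.ReflexiveTransitive using (ε; _◅_; _◅◅_)
  open import Relation.Binary.Construct.Closure.Symmetric using (fwd; bwd)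
  import Relation.Binary.Construct.Closure.Equivalence as Eq
  open import Function using (_∘_; id; _⇔_; mk⇔; Equivalence)
  open import Function.Construct.Symmetry using (⇔-sym)

  private variable
    n m a b t : ℕ
    C D S : Graph n

  open Equivalence using (to; from)

  -- Connectivity and independence modulo contracted edges

  Adj Conn : Graph n → Fin n → Fin n → Set
  Adj C u v = (u , v) ∈ C
  Conn C = Eq.EqClosure (Adj C)

  infix 4 _⊑_ _≈_
  -- Compares connectivity, not edge lists: lists of contracted edges with the same components are
  -- interchangeable for counting, see `count-resp`.
  _⊑_ _≈_ : Graph n → Graph n → Set
  C ⊑ D = ∀ {x y} → (x , y) ∈ C → Conn D x y
  C ≈ D = C ⊑ D × D ⊑ C

  conn-mono : C ⊑ D → ∀ {x y} → Conn C x y → Conn D x y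
  conn-mono C⊑D p = (C⊑D Eq.⋆) p

  ⊆⇒⊑ : (∀ {e} → e ∈ C → e ∈ D) → C ⊑ D
  ⊆⇒⊑ C⊆D e∈C = Eq.return (C⊆D e∈C)

  ∷-⊑ : ∀ {e} → C ⊑ D → (e ∷ C) ⊑ (e ∷ D)
  ∷-⊑ C⊑D (here refl) = Eq.return (here refl)
  ∷-⊑ C⊑D (there e∈C) = conn-mono (⊆⇒⊑ there) (C⊑D e∈C)

  ∷-swap : ∀ {e f} → (e ∷ f ∷ C) ⊑ (f ∷ e ∷ C)
  ∷-swap (here refl) = Eq.return (there (here refl))
  ∷-swap (there (here refl)) = Eq.return (here refl)
  ∷-swap (there (there e∈C)) = Eq.return (there (there e∈C))

  ∷-flip : ∀ {x y} → ((x , y) ∷ C) ⊑ ((y , x) ∷ C)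
  ∷-flip (here refl) = Eq.symmetric _ (Eq.return (here refl))
  ∷-flip (there e∈C) = Eq.return (there e∈C)

  ∷-++ : ∀ {e} (S : Graph n) → (e ∷ S ++ C) ≈ (S ++ e ∷ C)
  ∷-++ {C = C} {e} S = ⊆⇒⊑ forth , ⊆⇒⊑ back
    where
    forth : ∀ {f} → f ∈ e ∷ S ++ C → f ∈ S ++ e ∷ C
    forth (here refl) = ∈-++⁺ʳ S (here refl)
    forth (there f∈) with ∈-++⁻ S f∈
    ... | inj₁ f∈S = ∈-++⁺ˡ f∈S
    ... | inj₂ f∈C = ∈-++⁺ʳ S (there f∈C)
    back : ∀ {f} → f ∈ S ++ e ∷ C → f ∈ e ∷ S ++ C
    back f∈ with ∈-++⁻ S f∈
    ... | inj₁ f∈S = there (∈-++⁺ˡ f∈S)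
    ... | inj₂ (here refl) = here refl
    ... | inj₂ (there f∈C) = there (∈-++⁺ʳ S f∈C)

  ++-⊑ : (S : Graph n) → C ⊑ D → (S ++ C) ⊑ (S ++ D)
  ++-⊑ S C⊑D e∈ with ∈-++⁻ S e∈
  ... | inj₁ e∈S = Eq.return (∈-++⁺ˡ e∈S)
  ... | inj₂ e∈C = conn-mono (⊆⇒⊑ (∈-++⁺ʳ S)) (C⊑D e∈C)

  conn-sym : ∀ {x y} → Conn C x y → Conn C y x
  conn-sym = Eq.symmetric _

  both : (Fin n → Fin m) → Fin n × Fin n → Fin m × Fin m
  both f = Prod.map f f

  image : (Fin n → Fin m) → Graph n → Graph m
  image f = map (both f)

  conn-image : (f : Fin n → Fin m) → ∀ {x y} → Conn C x y → Conn (image f C) (f x) (f y)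
  conn-image f = Eq.gmap f (∈-map⁺ (both f))

  -- A path using the edge (s , t) can be shortened to use it at most once.
  conn-∷⁻ : ∀ {s t x y : Fin n} → Conn ((s , t) ∷ C) x y →
    Conn C x y ⊎ (Conn C x s × Conn C t y) ⊎ (Conn C x t × Conn C s y)
  conn-∷⁻ ε = inj₁ ε
  conn-∷⁻ (fwd (here refl) ◅ p) with conn-∷⁻ p
  ... | inj₁ q = inj₂ (inj₁ (ε , q))
  ... | inj₂ (inj₁ (q , r)) = inj₂ (inj₁ (ε , r))
  ... | inj₂ (inj₂ (q , r)) = inj₁ r
  conn-∷⁻ (bwd (here refl) ◅ p) with conn-∷⁻ p
  ... | inj₁ q = inj₂ (inj₂ (ε , q))
  ... | inj₂ (inj₁ (q , r)) = inj₁ r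
  ... | inj₂ (inj₂ (q , r)) = inj₂ (inj₂ (ε , r))
  conn-∷⁻ (fwd (there e∈) ◅ p) = Sum.map (fwd e∈ ◅_) (Sum.map (Prod.map₁ (fwd e∈ ◅_)) (Prod.map₁ (fwd e∈ ◅_))) (conn-∷⁻ p)
  conn-∷⁻ (bwd (there e∈) ◅ p) = Sum.map (bwd e∈ ◅_) (Sum.map (Prod.map₁ (bwd e∈ ◅_)) (Prod.map₁ (bwd e∈ ◅_))) (conn-∷⁻ p)

  -- Acyclicity modulo `C`, each edge being tested only against `C` and the edges before it.
  -- Choosing the head edge thus moves it from the tree into `C` by definition.
  Indep : Graph n → Graph n → Set
  Indep C [] = ⊤
  Indep C ((u , v) ∷ S) = ¬ Conn C u v × Indep ((u , v) ∷ C) S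

  Spans : Graph n → Set
  Spans C = ∀ u v → Conn C u v

  -- S is a spanning tree after contraction of the edges in C.
  Tree : Graph n → Graph n → Set
  Tree C S = Spans (S ++ C) × Indep C S

  indep-anti : (S : Graph n) → D ⊑ C → Indep C S → Indep D S
  indep-anti [] D⊑C _ = tt
  indep-anti (_ ∷ S) D⊑C (¬uv , ind) = ¬uv ∘ conn-mono D⊑C , indep-anti S (∷-⊑ D⊑C) ind

  tree-resp : C ≈ D → Tree C S → Tree D S
  tree-resp {S = S} (C⊑D , D⊑C) (spans , ind) =
    (λ u v → conn-mono (++-⊑ S C⊑D) (spans u v)) , indep-anti S D⊑C ind

  tree-∷⁺ : ∀ {u v} → ¬ Conn C u v → Tree ((u , v) ∷ C) S → Tree C ((u , v) ∷ S)
  tree-∷⁺ {S = S} ¬uv (spans , ind) =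
    (λ x y → conn-mono (proj₂ (∷-++ S)) (spans x y)) , ¬uv , ind

  tree-∷⁻ : ∀ {u v} → Tree C ((u , v) ∷ S) → ¬ Conn C u v × Tree ((u , v) ∷ C) S
  tree-∷⁻ {S = S} (spans , ¬uv , ind) =
    ¬uv , (λ x y → conn-mono (proj₁ (∷-++ S)) (spans x y)) , ind

  -- The last edge of S on a path from u to v would lie on a cycle through (u , v).
  indep-exchange : ∀ (S : Graph n) {u v} → Indep ((u , v) ∷ C) S → Conn (S ++ C) u v → Conn C u v
  indep-exchange [] _ p = p
  indep-exchange {C = C} (f ∷ S) (¬f , ind) p
    with conn-∷⁻ (indep-exchange S (indep-anti S ∷-swap ind) (conn-mono (proj₁ (∷-++ S)) p))
  ... | inj₁ q = q
  ... | inj₂ (inj₁ (q , r)) = ⊥-elim (¬f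
    (conn-mono (⊆⇒⊑ there) (conn-sym q) ◅◅ Eq.return (here refl) ◅◅ conn-mono (⊆⇒⊑ there) (conn-sym r)))
  ... | inj₂ (inj₂ (q , r)) = ⊥-elim (¬f
    (conn-mono (⊆⇒⊑ there) r ◅◅ conn-sym (Eq.return (here refl)) ◅◅ conn-mono (⊆⇒⊑ there) q))

  -- An abstract quotient, as two instances are needed: `merge` from the statement, and `pendant`,
  -- which folds a new vertex onto an old one.
  record Contracts (f : Fin n → Fin m) (s t : Fin n) : Set where
    field
      glues   : f s ≡ f t
      kernel  : ∀ {x y} → f x ≡ f y → Conn ((s , t) ∷ []) x y
      section : Fin m → Fin n
      isSection : ∀ y → f (section y) ≡ y

  module _ {f : Fin n → Fin m} {s t : Fin n} (contracts : Contracts f s t) where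
    open Contracts contracts

    conn-contract : ∀ {x y} → Conn ((s , t) ∷ C) x y → Conn (image f C) (f x) (f y)
    conn-contract = Eq.gfold (Eq.isEquivalence _) f
      λ { (here refl) → subst (Conn _ _) glues ε
        ; (there e∈) → Eq.return (∈-map⁺ (both f) e∈) }

    kernel-∷ : ∀ {x y} → f x ≡ f y → Conn ((s , t) ∷ C) x y
    kernel-∷ eq = conn-mono (⊆⇒⊑ λ { (here refl) → here refl }) (kernel eq)

    section-image : ∀ {x} → Conn ((s , t) ∷ C) (section (f x)) x
    section-image = kernel-∷ (isSection _)

    -- Every edge of a path in the quotient comes from an edge of `C`, whose ends are joined to the
    -- chosen representatives by `(s , t)` alone.
    conn-uncontract : ∀ {x y} → Conn (image f C) (f x) (f y) → Conn ((s , t) ∷ C) x y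
    conn-uncontract {C = C} p = conn-sym section-image ◅◅
      Eq.gfold (Eq.isEquivalence _) section lift p ◅◅ section-image
      where
      lift : ∀ {x y} → Adj (image f C) x y → Conn ((s , t) ∷ C) (section x) (section y)
      lift e∈ with ∈-map⁻ (both f) e∈
      ... | _ , e∈C , refl = section-image ◅◅ Eq.return (there e∈C) ◅◅ conn-sym section-image

    indep-contract : ∀ S → Indep ((s , t) ∷ C) S → Indep (image f C) (image f S)
    indep-contract [] _ = tt
    indep-contract (_ ∷ S) (¬uv , ind) =
      ¬uv ∘ conn-uncontract , indep-contract S (indep-anti S ∷-swap ind)

    indep-uncontract : ∀ S → Indep (image f C) (image f S) → Indep ((s , t) ∷ C) S
    indep-uncontract [] _ = tt
    indep-uncontract (_ ∷ S) (¬uv , ind) =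
      ¬uv ∘ conn-contract , indep-anti S ∷-swap (indep-uncontract S ind)

    tree-contract : ∀ S → Tree ((s , t) ∷ C) S ⇔ Tree (image f C) (image f S)
    tree-contract {C = C} S = mk⇔
      (λ (spans , ind) →
        (λ x y → subst₂ (Conn _) (isSection x) (isSection y)
          (subst (λ D → Conn D _ _) (map-++ (both f) S C)
            (conn-contract (conn-mono (proj₂ (∷-++ S)) (spans (section x) (section y)))))) ,
        indep-contract S ind)
      (λ (spans , ind) →
        (λ x y → conn-mono (proj₁ (∷-++ S))
          (conn-uncontract (subst (λ D → Conn D _ _) (sym (map-++ (both f) S C)) (spans (f x) (f y))))) ,
        indep-uncontract S ind)

  -- Edge subsets, spanning trees and their enumeration

  select : (G : Graph n) → Subset (length G) → Graph n
  select [] [] = []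
  select (e ∷ G) (true ∷ T) = e ∷ select G T
  select (e ∷ G) (false ∷ T) = select G T

  ∈-select⁺ : ∀ (G : Graph n) {T i} → i Sub.∈ T → List.lookup G i ∈ select G T
  ∈-select⁺ (e ∷ G) here = here refl
  ∈-select⁺ (e ∷ G) {true ∷ _} (there i∈T) = there (∈-select⁺ G i∈T)
  ∈-select⁺ (e ∷ G) {false ∷ _} (there i∈T) = ∈-select⁺ G i∈T

  ∈-select⁻ : ∀ (G : Graph n) T {e} → e ∈ select G T → ∃ λ i → i Sub.∈ T × List.lookup G i ≡ e
  ∈-select⁻ [] [] ()
  ∈-select⁻ (e ∷ G) (true ∷ T) (here refl) = zero , here , refl
  ∈-select⁻ (e ∷ G) (true ∷ T) (there e∈) = Prod.map suc (Prod.map₁ there) (∈-select⁻ G T e∈)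
  ∈-select⁻ (e ∷ G) (false ∷ T) e∈ = Prod.map suc (Prod.map₁ there) (∈-select⁻ G T e∈)

  reach⇒conn : ∀ {G : Graph n} {T x y} → Reach G T x y → Conn (select G T) x y
  reach⇒conn here = ε
  reach⇒conn {G = G} (step i i∈T (inj₁ eq) p) = fwd (subst (_∈ _) eq (∈-select⁺ G i∈T)) ◅ reach⇒conn p
  reach⇒conn {G = G} (step i i∈T (inj₂ eq) p) = bwd (subst (_∈ _) eq (∈-select⁺ G i∈T)) ◅ reach⇒conn p

  conn⇒reach : ∀ {G : Graph n} {T x y} → Conn (select G T) x y → Reach G T x y
  conn⇒reach ε = here
  conn⇒reach {G = G} (fwd e∈ ◅ p) = let i , i∈T , eq = ∈-select⁻ G _ e∈ in step i i∈T (inj₁ eq) (conn⇒reach p)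
  conn⇒reach {G = G} (bwd e∈ ◅ p) = let i , i∈T , eq = ∈-select⁻ G _ e∈ in step i i∈T (inj₂ eq) (conn⇒reach p)

  Bridges : Graph n → (G : Graph n) → Subset (length G) → Set
  Bridges C G T = ∀ i → i Sub.∈ T → ¬ Conn (select G (T [ i ]≔ outside) ++ C) (src G i) (tgt G i)

  bridges⇒indep : ∀ (G : Graph n) T → Bridges C G T → Indep C (select G T)
  bridges⇒indep [] [] _ = tt
  bridges⇒indep (e ∷ G) (true ∷ T) br =
    br zero here ∘ conn-mono (⊆⇒⊑ (∈-++⁺ʳ (select G T))) ,
    bridges⇒indep G T (λ i i∈T → br (suc i) (there i∈T) ∘ conn-mono (proj₂ (∷-++ (select G _))))
  bridges⇒indep (e ∷ G) (false ∷ T) br = bridges⇒indep G T (λ i i∈T → br (suc i) (there i∈T))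

  -- Independence tests an edge only against earlier ones, a bridge against all others;
  -- `indep-exchange` covers the later edges.
  indep⇒bridges : ∀ (G : Graph n) T → Indep C (select G T) → Bridges C G T
  indep⇒bridges (e ∷ G) (true ∷ T) (¬e , ind) zero here = ¬e ∘ indep-exchange (select G T) ind
  indep⇒bridges (e ∷ G) (true ∷ T) (¬e , ind) (suc i) (there i∈T) =
    indep⇒bridges G T ind i i∈T ∘ conn-mono (proj₁ (∷-++ (select G _)))
  indep⇒bridges (e ∷ G) (false ∷ T) ind (suc i) (there i∈T) = indep⇒bridges G T ind i i∈T

  ++-[] : (S : Graph n) → S ≈ (S ++ [])
  ++-[] S = ⊆⇒⊑ ∈-++⁺ˡ , ⊆⇒⊑ (λ e∈ → Sum.[ id , (λ ()) ] (∈-++⁻ S e∈))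

  tree⇔spanningTree : ∀ (G : Graph n) T → Tree [] (select G T) ⇔ SpanningTree G T
  tree⇔spanningTree G T = mk⇔
    (λ (spans , ind) →
      (λ x y → conn⇒reach (conn-mono (proj₂ (++-[] _)) (spans x y))) ,
      (λ i i∈T p → indep⇒bridges G T ind i i∈T (conn-mono (proj₁ (++-[] _)) (reach⇒conn p))))
    (λ (conn , br) →
      (λ x y → conn-mono (proj₁ (++-[] _)) (reach⇒conn (conn x y))) ,
      bridges⇒indep G T (λ i i∈T p → br i i∈T (conn⇒reach (conn-mono (proj₂ (++-[] _)) p))))

  Enum : ∀ {A : Set} → (A → Set) → ℕ → Set
  Enum {A} P t = Σ[ L ∈ List A ] Unique L × length L ≡ t × (∀ x → (x ∈ L) ⇔ P x)

  enum-⇔ : ∀ {A : Set} {P Q : A → Set} → (∀ x → P x ⇔ Q x) → Enum P t → Enum Q t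
  enum-⇔ P⇔Q (L , uniq , len , mem) =
    L , uniq , len , λ x → mk⇔ (to (P⇔Q x) ∘ to (mem x)) (from (mem x) ∘ from (P⇔Q x))

  enum-none : ∀ {A : Set} {P : A → Set} → (∀ x → ¬ P x) → Enum P 0
  enum-none ¬P = [] , [] , refl , λ x → mk⇔ (λ ()) (⊥-elim ∘ ¬P x)

  enum-∷ : ∀ {k} {P : Subset (suc k) → Set} →
    Enum (P ∘ (inside ∷_)) a → Enum (P ∘ (outside ∷_)) b → Enum P (a + b)
  enum-∷ {k = k} {P = P} (L , uniqL , lenL , memL) (M , uniqM , lenM , memM) =
    map (inside ∷_) L ++ map (outside ∷_) M ,
    Uniqueₚ.++⁺ (Uniqueₚ.map⁺ ∷-injectiveʳ uniqL) (Uniqueₚ.map⁺ ∷-injectiveʳ uniqM) disjoint ,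
    trans (length-++ (map (inside ∷_) L))
      (cong₂ _+_ (trans (length-map (inside ∷_) L) lenL) (trans (length-map (outside ∷_) M) lenM)) ,
    λ T → mk⇔ (Sum.[ fromL , fromM ] ∘ ∈-++⁻ (map (inside ∷_) L)) (back T)
    where
    disjoint : ∀ {x} → ¬ (x ∈ map (inside ∷_) L × x ∈ map (outside ∷_) M)
    disjoint (x∈L , x∈M) with ∈-map⁻ (inside ∷_) x∈L | ∈-map⁻ (outside ∷_) x∈M
    ... | _ , _ , refl | _ , _ , ()
    fromL : ∀ {T} → T ∈ map (inside ∷_) L → P T
    fromL T∈ with ∈-map⁻ (inside ∷_) T∈
    ... | T , T∈L , refl = to (memL T) T∈L
    fromM : ∀ {T} → T ∈ map (outside ∷_) M → P T
    fromM T∈ with ∈-map⁻ (outside ∷_) T∈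
    ... | T , T∈M , refl = to (memM T) T∈M
    back : ∀ T → P T → T ∈ map (inside ∷_) L ++ map (outside ∷_) M
    back (true ∷ T) pT = ∈-++⁺ˡ (∈-map⁺ _ (from (memL T) pT))
    back (false ∷ T) pT = ∈-++⁺ʳ _ (∈-map⁺ _ (from (memM T) pT))

  -- A graph and its image have lengths that are equal only propositionally, so their edge subsets
  -- have different types.
  enum-cast : ∀ {k l} {P : Subset k → Set} (eq : l ≡ k) → Enum P t ⇔ Enum (P ∘ Vec.cast eq) t
  enum-cast {P = P} refl = mk⇔
    (enum-⇔ λ T → mk⇔ (subst P (sym (cast-is-id refl T))) (subst P (cast-is-id refl T)))
    (enum-⇔ λ T → mk⇔ (subst P (cast-is-id refl T)) (subst P (sym (cast-is-id refl T))))

  -- A record rather than a synonym for Enum, so that unification can read off C and G.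
  record Count (C G : Graph n) (t : ℕ) : Set where
    constructor counted
    field enum : Enum (Tree C ∘ select G) t

  open Count using (enum)

  count⇒numSpanningTrees : {G : Graph n} → Count [] G t → NumSpanningTrees G t
  count⇒numSpanningTrees {G = G} = enum-⇔ (tree⇔spanningTree G) ∘ enum

  count-resp : {G : Graph n} → C ≈ D → Count C G t → Count D G t
  count-resp C≈D@(C⊑D , D⊑C) =
    counted ∘ enum-⇔ (λ T → mk⇔ (tree-resp C≈D) (tree-resp (D⊑C , C⊑D))) ∘ enum

  count-[] : Spans C → Count C [] 1
  count-[] spans = counted (([] ∷ []) , ([] ∷ []) , refl ,
    λ { [] → mk⇔ (λ _ → spans , tt) (λ _ → here refl) })

  deletion-contraction : ∀ {G : Graph n} {u v} → ¬ Conn C u v →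
    Count ((u , v) ∷ C) G a → Count C G b → Count C ((u , v) ∷ G) (a + b)
  deletion-contraction ¬uv contracted deleted = counted (enum-∷
    (enum-⇔ (λ T → mk⇔ (tree-∷⁺ ¬uv) (proj₂ ∘ tree-∷⁻)) (enum contracted)) (enum deleted))

  count-loop : ∀ {G : Graph n} {u v} → Conn C u v → Count C G b → Count C ((u , v) ∷ G) b
  count-loop uv count = counted (enum-∷ (enum-none λ T tree → proj₁ (tree-∷⁻ tree) uv) (enum count))

  select-image : ∀ (f : Fin n → Fin m) G T →
    image f (select G (Vec.cast (length-map (both f) G) T)) ≡ select (image f G) T
  select-image f [] [] = refl
  select-image f (e ∷ G) (true ∷ T) = cong (both f e ∷_) (select-image f G T)
  select-image f (e ∷ G) (false ∷ T) = select-image f G T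

  -- The bridge from formal contraction to a real quotient of the vertex set.
  count-contract : ∀ {f : Fin n → Fin m} {s t} → Contracts f s t → ∀ G →
    Count ((s , t) ∷ C) G a ⇔ Count (image f C) (image f G) a
  count-contract {C = C} {f = f} contracts G = mk⇔
    (counted ∘ enum-⇔ same ∘ to (enum-cast eq) ∘ enum-⇔ (λ T → tree-contract contracts (select G T)) ∘ enum)
    (counted ∘ enum-⇔ (λ T → ⇔-sym (tree-contract contracts (select G T))) ∘ from (enum-cast eq)
      ∘ enum-⇔ (⇔-sym ∘ same) ∘ enum)
    where
    eq = length-map (both f) G
    same : ∀ T → Tree (image f C) (image f (select G (Vec.cast eq T))) ⇔ Tree (image f C) (select (image f G) T)
    same T = subst (λ S → Tree (image f C) (image f (select G (Vec.cast eq T))) ⇔ Tree (image f C) S)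
      (select-image f G T) (mk⇔ id id)

  -- Adding one vertex with at most two edges

  lift : Graph n → Graph (suc n)
  lift = image suc

  pendant : Fin n → Fin (suc n) → Fin n
  pendant u zero = u
  pendant u (suc x) = x

  image-pendant : ∀ (u : Fin n) C → image (pendant u) (lift C) ≡ C
  image-pendant u C = trans (sym (map-∘ C)) (map-id C)

  pendant-contracts : (u : Fin n) → Contracts (pendant u) (suc u) zero
  pendant-contracts u = record
    { glues = refl
    ; kernel = λ {x} {y} → kernel x y
    ; section = suc
    ; isSection = λ _ → refl
    }
    where
    kernel : ∀ x y → pendant u x ≡ pendant u y → Conn ((suc u , zero) ∷ []) x y
    kernel zero zero _ = ε
    kernel zero (suc y) refl = conn-sym (Eq.return (here refl))
    kernel (suc x) zero refl = Eq.return (here refl)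
    kernel (suc x) (suc y) refl = ε

  -- Folding the new vertex onto `x` is a left inverse of the inclusion, so it carries the path
  -- back.
  conn-lift⁻ : ∀ {x y : Fin n} → Conn (lift C) (suc x) (suc y) → Conn C x y
  conn-lift⁻ {C = C} {x = x} p = subst (λ D → Conn D _ _) (image-pendant x C) (conn-image (pendant x) p)

  isolated : ∀ {x : Fin n} → ¬ Conn (lift C) zero (suc x)
  isolated {C = C} p = avoids p refl refl
    where
    avoids : ∀ {x y z} → Conn (lift C) x y → x ≡ zero → y ≢ suc z
    avoids ε refl ()
    avoids (fwd e∈ ◅ p) eq with ∈-map⁻ (both suc) e∈
    avoids (fwd e∈ ◅ p) () | _ , _ , refl
    avoids (bwd e∈ ◅ p) eq with ∈-map⁻ (both suc) e∈
    avoids (bwd e∈ ◅ p) () | _ , _ , refl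

  count-pendant : ∀ (u : Fin n) {G} → Count C G t → Count ((suc u , zero) ∷ lift C) (lift G) t
  count-pendant {C = C} {t = t} u {G} count = from (count-contract (pendant-contracts u) (lift G))
    (subst₂ (λ D H → Count D H t) (sym (image-pendant u C)) (sym (image-pendant u G)) count)

  select-lift : ∀ (G : Graph n) T → ∃ λ S → select (lift G) T ≡ lift S
  select-lift [] [] = [] , refl
  select-lift (e ∷ G) (true ∷ T) = Prod.map (e ∷_) (cong (_ ∷_)) (select-lift G T)
  select-lift (e ∷ G) (false ∷ T) = select-lift G T

  -- The argument `u` supplies a second vertex; on one vertex the empty tree would span.
  count-isolated : ∀ (u : Fin n) {C G} → Count (lift C) (lift G) 0
  count-isolated u {C} {G} = counted (enum-none none)
    where
    none : ∀ T → ¬ Tree (lift C) (select (lift G) T)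
    none T (spans , _) with select-lift G T
    ... | S , eq = isolated {C = S ++ C}
      (subst (λ D → Conn D zero (suc u)) (trans (cong (_++ lift C) eq) (sym (map-++ (both suc) S C))) (spans zero (suc u)))

  cherry : Fin n → Fin n → Graph n → Graph (suc n)
  cherry u v R = (suc u , zero) ∷ (suc v , zero) ∷ lift R

  -- Four cases at the new vertex: both edges act like a contracted `(u , v)`, either one alone
  -- makes the vertex pendant, and neither leaves it isolated. They contribute `a`, `b`, `b` and 0.
  count-cherry : ∀ {u v : Fin n} {R} → ¬ Conn C u v →
    Count ((u , v) ∷ C) R a → Count C R b → Count (lift C) (cherry u v R) ((a + b) + (b + 0))
  count-cherry {C = C} {u = u} {v} ¬uv contracted deleted =
    deletion-contraction (isolated ∘ conn-sym)
      (deletion-contraction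
        (λ p → ¬uv (subst (λ D → Conn D u v) (image-pendant u C)
          (conn-sym (conn-contract (pendant-contracts u) p))))
        (count-resp triangle (count-pendant u contracted))
        (count-pendant u deleted))
      (deletion-contraction (isolated ∘ conn-sym) (count-pendant v deleted) (count-isolated u))
    where
    base : (D : Graph _) → Conn D (suc u) zero → Conn D (suc v) zero → lift C ⊑ D →
      ((suc u , zero) ∷ lift ((u , v) ∷ C)) ⊑ D
    base D u0 v0 C⊑D (here refl) = u0
    base D u0 v0 C⊑D (there (here refl)) = u0 ◅◅ conn-sym v0
    base D u0 v0 C⊑D (there (there e∈)) = C⊑D e∈
    -- Any two sides of a triangle connect the same three vertices.
    triangle : ((suc u , zero) ∷ lift ((u , v) ∷ C)) ≈ ((suc v , zero) ∷ (suc u , zero) ∷ lift C)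
    triangle =
      base _ (Eq.return (there (here refl))) (Eq.return (here refl)) (⊆⇒⊑ (λ e∈ → there (there e∈))) ,
      λ { (here refl) → conn-sym (Eq.return (there (here refl))) ◅◅ Eq.return (here refl)
        ; (there (here refl)) → Eq.return (here refl)
        ; (there (there e∈)) → Eq.return (there (there e∈)) }

  -- Both edges together would close a cycle through `C`, so exactly one of them is chosen.
  count-cherry-closed : ∀ {u v : Fin n} {R} → Conn C u v →
    Count C R b → Count (lift C) (cherry u v R) (b + (b + 0))
  count-cherry-closed {C = C} {u = u} {v} uv count =
    deletion-contraction (isolated ∘ conn-sym)
      (count-loop (conn-mono (⊆⇒⊑ there) (conn-sym (conn-image suc uv)) ◅◅ Eq.return (here refl))
        (count-pendant u count))
      (deletion-contraction (isolated ∘ conn-sym) (count-pendant v count) (count-isolated u))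

  -- Series-parallel networks and their spanning trees

  -- Two-terminal networks; leaf is a path of length two, so that terminals are never adjacent.
  data Net : Set where
    leaf : Net
    ser par : Net → Net → Net

  ext : Net → ℕ → ℕ
  ext leaf n = suc n
  ext (ser p q) n = ext p (ext q (suc n))
  ext (par p q) n = ext p (ext q n)

  emb : ∀ p → Fin n → Fin (ext p n)
  emb leaf = suc
  emb (ser p q) = emb p ∘ emb q ∘ suc
  emb (par p q) = emb p ∘ emb q

  -- Components are inserted successively: `q` already belongs to the surrounding graph when `p`
  -- arrives. In a series composition `zero` is the middle vertex.
  insert : ∀ p → Fin n → Fin n → Graph n → Graph (ext p n)
  insert leaf u v R = cherry u v R
  insert (ser p q) u v R = insert p (emb q (suc u)) (emb q zero) (insert q zero (suc v) (lift R))
  insert (par p q) u v R = insert p (emb q u) (emb q v) (insert q u v R)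

  -- Carries contracted edges over to the enlarged vertex set, where the new vertices are isolated.
  extend : ∀ p → Graph n → Graph (ext p n)
  extend leaf = lift
  extend (ser p q) = extend p ∘ extend q ∘ lift
  extend (par p q) = extend p ∘ extend q

  extend-∷ : ∀ p {e} (C : Graph n) → extend p (e ∷ C) ≡ both (emb p) e ∷ extend p C
  extend-∷ leaf C = refl
  extend-∷ (ser p q) C = trans (cong (extend p) (extend-∷ q (lift C))) (extend-∷ p _)
  extend-∷ (par p q) C = trans (cong (extend p) (extend-∷ q C)) (extend-∷ p _)

  extend-[] : ∀ p → extend {n} p [] ≡ []
  extend-[] leaf = refl
  extend-[] (ser p q) = trans (cong (extend p) (extend-[] q)) (extend-[] p)
  extend-[] (par p q) = trans (cong (extend p) (extend-[] q)) (extend-[] p)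

  conn-extend⁻ : ∀ p {x y : Fin n} → Conn (extend p C) (emb p x) (emb p y) → Conn C x y
  conn-extend⁻ leaf = conn-lift⁻
  conn-extend⁻ (ser p q) = conn-lift⁻ ∘ conn-extend⁻ q ∘ conn-extend⁻ p
  conn-extend⁻ (par p q) = conn-extend⁻ q ∘ conn-extend⁻ p

  conn-extend⁺ : ∀ p {x y : Fin n} → Conn C x y → Conn (extend p C) (emb p x) (emb p y)
  conn-extend⁺ leaf = conn-image suc
  conn-extend⁺ (ser p q) = conn-extend⁺ p ∘ conn-extend⁺ q ∘ conn-image suc
  conn-extend⁺ (par p q) = conn-extend⁺ p ∘ conn-extend⁺ q

  -- Numbers of spanning trees, and of spanning forests with two components separating the terminals.
  trees forests : Net → ℕ
  trees leaf = 1
  trees (ser p q) = trees p * trees q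
  trees (par p q) = trees p * forests q + forests p * trees q
  forests leaf = 2
  forests (ser p q) = trees p * forests q + forests p * trees q
  forests (par p q) = forests p * forests q

  -- A spanning tree meets the network either in a tree, which acts on the rest like a contracted
  -- `(u , v)`, or in a forest separating the terminals, which leaves the rest unchanged. Generality
  -- in `C` and `R` lets the induction hypothesis apply with `q` already in place.
  count-insert : ∀ p {u v : Fin n} {R} → ¬ Conn C u v →
    Count ((u , v) ∷ C) R a → Count C R b → Count (extend p C) (insert p u v R) (trees p * a + forests p * b)
  -- A tree of the network would close a cycle through `C`; only the separating forests survive.
  count-insert-closed : ∀ p {u v : Fin n} {R} → Conn C u v →
    Count C R b → Count (extend p C) (insert p u v R) (forests p * b)

  count-insert {a = a} {b = b} leaf ¬uv contracted deleted =
    subst (Count _ _) (lemma a b) (count-cherry ¬uv contracted deleted)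
    where
    lemma : ∀ a b → (a + b) + (b + 0) ≡ 1 * a + 2 * b
    lemma = solve-∀
  count-insert {C = C} {a = a} {b = b} (ser p q) {u} {v} ¬uv contracted deleted =
    subst (Count _ _) (lemma (trees p) (forests p) (trees q) (forests q) a b)
      (count-insert p (λ w → isolated (conn-sym (conn-extend⁻ q w)))
        (subst (λ D → Count D _ _) (extend-∷ q (lift C))
          (count-insert q
            (λ w → ¬uv (subst (λ D → Conn D u v) (image-pendant u C) (conn-contract (pendant-contracts u) w)))
            (count-resp triangle (count-pendant u contracted))
            (count-pendant u deleted)))
        -- Here `p` does not join `u` to the middle vertex, which must then reach `v` through `q`;
        -- otherwise it is cut off, whence the count 0.
        (count-insert q isolated
          (count-resp (∷-flip , ∷-flip) (count-pendant v deleted)) (count-isolated u)))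
    where
    lemma : ∀ A B A′ B′ a b → A * (A′ * a + B′ * b) + B * (A′ * b + B′ * 0) ≡ A * A′ * a + (A * B′ + B * A′) * b
    lemma = solve-∀
    triangle : ((suc u , zero) ∷ lift ((u , v) ∷ C)) ≈ ((zero , suc v) ∷ (suc u , zero) ∷ lift C)
    triangle =
      (λ { (here refl) → Eq.return (there (here refl))
         ; (there (here refl)) → Eq.return (there (here refl)) ◅◅ Eq.return (here refl)
         ; (there (there e∈)) → Eq.return (there (there e∈)) }) ,
      λ { (here refl) → conn-sym (Eq.return (here refl)) ◅◅ Eq.return (there (here refl))
        ; (there (here refl)) → Eq.return (here refl)
        ; (there (there e∈)) → Eq.return (there (there e∈)) }
  count-insert {C = C} {a = a} {b = b} (par p q) ¬uv contracted deleted =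
    subst (Count _ _) (lemma (trees p) (forests p) (trees q) (forests q) a b)
      (count-insert p (¬uv ∘ conn-extend⁻ q)
        -- Contracting the terminals of `p` contracts those of `q` as well.
        (subst (λ D → Count D _ _) (extend-∷ q C) (count-insert-closed q (Eq.return (here refl)) contracted))
        (count-insert q ¬uv contracted deleted))
    where
    lemma : ∀ A B A′ B′ a b → A * (B′ * a) + B * (A′ * a + B′ * b) ≡ (A * B′ + B * A′) * a + B * B′ * b
    lemma = solve-∀

  count-insert-closed {b = b} leaf uv count = count-cherry-closed uv count
  count-insert-closed {C = C} {b = b} (ser p q) {u} {v} uv count =
    subst (Count _ _) (lemma (trees p) (forests p) (trees q) (forests q) b)
      (count-insert p (λ w → isolated (conn-sym (conn-extend⁻ q w)))
        (subst (λ D → Count D _ _) (extend-∷ q (lift C))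
          (count-insert-closed q
            (conn-sym (Eq.return (here refl)) ◅◅ conn-mono (⊆⇒⊑ there) (conn-image suc uv))
            (count-pendant u count)))
        (count-insert q isolated
          (count-resp (∷-flip , ∷-flip) (count-pendant v count)) (count-isolated u)))
    where
    lemma : ∀ A B A′ B′ b → A * (B′ * b) + B * (A′ * b + B′ * 0) ≡ (A * B′ + B * A′) * b
    lemma = solve-∀
  count-insert-closed {b = b} (par p q) uv count =
    subst (Count _ _) (lemma (forests p) (forests q) b)
      (count-insert-closed p (conn-extend⁺ q uv) (count-insert-closed q uv count))
    where
    lemma : ∀ B B′ b → B * (B′ * b) ≡ B * B′ * b
    lemma = solve-∀

module PlaneDrawings where

  open Counting
  open import Data.Nat using (ℕ; zero; suc)
  open import Data.Rational as ℚ using (ℚ; 0ℚ; 1ℚ; _+_; _-_; -_; _*_; 1/_; _<_; _⊔_; ≢-nonZero; positive; nonNegative)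
  import Data.Rational.Properties as ℚₚ
  open import Data.Rational.Solver using (module +-*-Solver)
  open import Data.Fin using (Fin; zero; suc)
  open import Data.Fin.Properties using (suc-injective)
  open import Data.List using ([]; _∷_)
  open import Data.List.Relation.Unary.All as All using (All; []; _∷_)
  import Data.List.Relation.Unary.All.Properties as Allₚ
  open import Data.List.Relation.Unary.AllPairs as AllPairs using (AllPairs; []; _∷_)
  import Data.List.Relation.Unary.AllPairs.Properties as AllPairsₚ
  open import Data.Product as Prod using (Σ-syntax; ∃; _×_; proj₁; proj₂; _,_)
  open import Data.Sum as Sum using (_⊎_; inj₁; inj₂)
  open import Relation.Nullary using (yes; no; contradiction)
  open import Relation.Binary.PropositionalEquality using (_≡_; _≢_; refl; sym; trans; cong; cong₂; subst; subst₂)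
  open import Relation.Binary using (tri<; tri≈; tri>)
  open import Function using (_∘_; id)

  private variable
    n m : ℕ

  open +-*-Solver

  -- Affine functionals on segments, and sufficiently large rationals

  0≤* : ∀ {p q} → 0ℚ ℚ.≤ p → 0ℚ ℚ.≤ q → 0ℚ ℚ.≤ p * q
  0≤* {p} {q} 0≤p 0≤q = subst (ℚ._≤ p * q) (ℚₚ.*-zeroʳ p) (ℚₚ.*-monoˡ-≤-nonNeg p {{nonNegative 0≤p}} 0≤q)

  0<* : ∀ {p q} → 0ℚ < p → 0ℚ < q → 0ℚ < p * q
  0<* {p} {q} 0<p 0<q = subst (_< p * q) (ℚₚ.*-zeroʳ p) (ℚₚ.*-monoʳ-<-pos p {{positive 0<p}} 0<q)

  *≤0 : ∀ {p q} → 0ℚ ℚ.≤ p → q ℚ.≤ 0ℚ → p * q ℚ.≤ 0ℚ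
  *≤0 {p} {q} 0≤p q≤0 = subst (p * q ℚ.≤_) (ℚₚ.*-zeroʳ p) (ℚₚ.*-monoˡ-≤-nonNeg p {{nonNegative 0≤p}} q≤0)

  ≤⇒0≤- : ∀ {p q} → p ℚ.≤ q → 0ℚ ℚ.≤ q - p
  ≤⇒0≤- {p} {q} p≤q = subst (ℚ._≤ q - p) (ℚₚ.+-inverseʳ p) (ℚₚ.+-monoˡ-≤ (- p) p≤q)

  ≤⇒-≤0 : ∀ {p q} → p ℚ.≤ q → p - q ℚ.≤ 0ℚ
  ≤⇒-≤0 {p} {q} p≤q = subst (p - q ℚ.≤_) (ℚₚ.+-inverseʳ q) (ℚₚ.+-monoˡ-≤ (- q) p≤q)

  <⇒0<- : ∀ {p q} → p < q → 0ℚ < q - p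
  <⇒0<- {p} {q} p<q = subst (_< q - p) (ℚₚ.+-inverseʳ p) (ℚₚ.+-monoˡ-< (- p) p<q)

  Affine : Set
  Affine = ℚ × ℚ × ℚ

  eval : Affine → Point → ℚ
  eval (α , β , γ) (x , y) = α * x + β * y + γ

  eval-segment : ∀ L z p q ((t , _) : OnSegment z p q) → eval L z ≡ (1ℚ - t) * eval L p + t * eval L q
  eval-segment (α , β , γ) _ (p₁ , p₂) (q₁ , q₂) (t , _ , _ , refl , refl) =
    solve 8 (λ α β γ p₁ p₂ q₁ q₂ t →
      α :* (p₁ :+ t :* (q₁ :- p₁)) :+ β :* (p₂ :+ t :* (q₂ :- p₂)) :+ γ :=
      (con 1ℚ :- t) :* (α :* p₁ :+ β :* p₂ :+ γ) :+ t :* (α :* q₁ :+ β :* q₂ :+ γ))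
      refl α β γ p₁ p₂ q₁ q₂ t

  eval-segment-≤ : ∀ L z p q → OnSegment z p q → eval L p ℚ.≤ 0ℚ → eval L q ℚ.≤ 0ℚ → eval L z ℚ.≤ 0ℚ
  eval-segment-≤ L z p q on@(t , 0≤t , t≤1 , _) Lp≤0 Lq≤0 = subst (ℚ._≤ 0ℚ) (sym (eval-segment L z p q on))
    (ℚₚ.+-mono-≤ (*≤0 (≤⇒0≤- t≤1) Lp≤0) (*≤0 0≤t Lq≤0))

  -- Along the segment the functional is (1 - t) `L p` + t `L q`, positive once t > 0. All
  -- separation of new edges rests on this.
  segment-start : ∀ L z p q → OnSegment z p q →
    0ℚ ℚ.≤ eval L p → 0ℚ < eval L q → eval L z ℚ.≤ 0ℚ → z ≡ p
  segment-start L z p q on@(t , 0≤t , t≤1 , z₁ , z₂) 0≤Lp 0<Lq Lz≤0 with ℚₚ.<-cmp 0ℚ t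
  ... | tri< 0<t _ _ = contradiction
    (ℚₚ.<-≤-trans (ℚₚ.+-mono-≤-< (0≤* (≤⇒0≤- t≤1) 0≤Lp) (0<* 0<t 0<Lq)) (subst (ℚ._≤ 0ℚ) (eval-segment L z p q on) Lz≤0))
    (ℚₚ.<-irrefl refl)
  ... | tri≈ _ refl _ = cong₂ _,_ (trans z₁ (at-start (proj₁ p) (proj₁ q))) (trans z₂ (at-start (proj₂ p) (proj₂ q)))
    where
    at-start : ∀ p q → p + 0ℚ * (q - p) ≡ p
    at-start = solve 2 (λ p q → p :+ con 0ℚ :* (q :- p) := p) refl
  ... | tri> _ _ t<0 = contradiction (ℚₚ.<-≤-trans t<0 0≤t) (ℚₚ.<-irrefl refl)

  segment-refl : ∀ p → OnSegment p p p
  segment-refl (x , y) = 0ℚ , ℚₚ.≤-refl , ℚₚ.nonNegative⁻¹ 1ℚ , at x , at y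
    where
    at : ∀ x → x ≡ x + 0ℚ * (x - x)
    at = solve 1 (λ x → x := x :+ con 0ℚ :* (x :- x)) refl

  segment-sym : ∀ z p q → OnSegment z p q → OnSegment z q p
  segment-sym _ (p₁ , p₂) (q₁ , q₂) (t , 0≤t , t≤1 , refl , refl) =
    1ℚ - t , ≤⇒0≤- t≤1 , subst (1ℚ - t ℚ.≤_) (ℚₚ.+-identityʳ 1ℚ) (ℚₚ.+-monoʳ-≤ 1ℚ (ℚₚ.neg-antimono-≤ 0≤t)) , flip p₁ q₁ t , flip p₂ q₂ t
    where
    flip : ∀ p q t → p + t * (q - p) ≡ q + (1ℚ - t) * (p - q)
    flip = solve 3 (λ p q t → p :+ t :* (q :- p) := q :+ (con 1ℚ :- t) :* (p :- q)) refl

  1/-scale : ∀ {d} → 0ℚ < d → ∃ λ e → d * e ≡ 1ℚ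
  1/-scale {d} 0<d = 1/_ d {{nz}} , ℚₚ.*-inverseʳ d {{nz}}
    where nz = ≢-nonZero (λ d≡0 → ℚₚ.<-irrefl (sym d≡0) 0<d)

  -- Slopes and heights face finitely many lower bounds; this form combines them by maxima.
  Eventually : (ℚ → Set) → Set
  Eventually P = Σ[ k ∈ ℚ ] (∀ {l} → k ℚ.≤ l → P l)

  eventually-× : ∀ {P Q} → Eventually P → Eventually Q → Eventually (λ k → P k × Q k)
  eventually-× (k , P≥k) (l , Q≥l) =
    k ⊔ l , λ m → P≥k (ℚₚ.≤-trans (ℚₚ.p≤p⊔q k l) m) , Q≥l (ℚₚ.≤-trans (ℚₚ.p≤q⊔p k l) m)

  eventually-∀ : ∀ {P : Fin n → ℚ → Set} → (∀ c → Eventually (P c)) → Eventually (λ k → ∀ c → P c k)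
  eventually-∀ {zero} ev = 0ℚ , λ _ ()
  eventually-∀ {suc n} ev with eventually-× (ev zero) (eventually-∀ (ev ∘ suc))
  ... | k , f = k , λ m → λ { zero → proj₁ (f m) ; (suc c) → proj₂ (f m) c }

  eventually-All : ∀ {A : Set} {P : A → ℚ → Set} {xs} → All (λ x → Eventually (P x)) xs →
    Eventually (λ k → All (λ x → P x k) xs)
  eventually-All [] = 0ℚ , λ _ → []
  eventually-All (px ∷ pxs) with eventually-× px (eventually-All pxs)
  ... | k , f = k , λ m → proj₁ (f m) ∷ proj₂ (f m)

  eventually-map : ∀ {P Q : ℚ → Set} → (∀ {k} → P k → Q k) → Eventually P → Eventually Q
  eventually-map P⇒Q (k , f) = k , λ m → P⇒Q (f m)

  eventually-≤* : ∀ {d} b → 0ℚ < d → Eventually (λ k → b ℚ.≤ d * k)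
  eventually-≤* {d} b 0<d with 1/-scale 0<d
  ... | e , de≡1 = b * e , λ {l} be≤l → subst (ℚ._≤ d * l) eq
    (ℚₚ.*-monoˡ-≤-nonNeg d {{nonNegative (ℚₚ.<⇒≤ 0<d)}} be≤l)
    where
    eq : d * (b * e) ≡ b
    eq = trans (solve 3 (λ d b e → d :* (b :* e) := b :* (d :* e)) refl d b e)
      (trans (cong (b *_) de≡1) (ℚₚ.*-identityʳ b))

  -- Asking merely that `x` differ from all values would not survive the induction: moving `x` to
  -- avoid one value could hit another. Staying below every value beyond `l` persists when `x`
  -- decreases.
  fresh : ∀ (f : Fin n → ℚ) {l r} → l < r → ∃ λ x → l < x × x < r × (∀ c → f c ℚ.≤ l ⊎ x < f c)
  fresh {zero} f l<r with ℚₚ.<-dense l<r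
  ... | x , l<x , x<r = x , l<x , x<r , λ ()
  fresh {suc n} f {l} l<r with fresh (f ∘ suc) l<r
  ... | x , l<x , x<r , avoids with f zero ℚ.≤? l | x ℚₚ.<? f zero
  ... | yes f≤l | _ = x , l<x , x<r , λ { zero → inj₁ f≤l ; (suc c) → avoids c }
  ... | no _ | yes x<f = x , l<x , x<r , λ { zero → inj₂ x<f ; (suc c) → avoids c }
  ... | no f≰l | no x≮f with ℚₚ.<-dense (ℚₚ.≰⇒> f≰l)
  ... | y , l<y , y<f = y , l<y , ℚₚ.<-trans y<x x<r ,
        λ { zero → inj₂ y<f ; (suc c) → Sum.map₂ (ℚₚ.<-trans y<x) (avoids c) }
    where y<x = ℚₚ.<-≤-trans y<f (ℚₚ.≮⇒≥ x≮f)

  -- Plane drawings with distinct abscissae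

  private variable
    pos : Fin n → Point
    R : Graph n

  X : (Fin n → Point) → Fin n → ℚ
  X pos c = proj₁ (pos c)

  leftOf rightOf : ℚ → Affine
  leftOf x = - 1ℚ , 0ℚ , x
  rightOf x = 1ℚ , 0ℚ , - x

  eval-leftOf : ∀ x p → eval (leftOf x) p ≡ x - proj₁ p
  eval-leftOf x (p , q) = solve 3 (λ x p q → (:- con 1ℚ) :* p :+ con 0ℚ :* q :+ x := x :- p) refl x p q

  eval-rightOf : ∀ x p → eval (rightOf x) p ≡ proj₁ p - x
  eval-rightOf x (p , q) = solve 3 (λ x p q → con 1ℚ :* p :+ con 0ℚ :* q :+ (:- x) := p :- x) refl x p q

  -- Positive above the line of slope m through the given point.
  above : Point → ℚ → Affine
  above (x , y) m = - m , 1ℚ , m * x - y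

  eval-above : ∀ p m q → eval (above p m) q ≡ (proj₂ q - proj₂ p) - m * (proj₁ q - proj₁ p)
  eval-above (x , y) m (x′ , y′) = solve 5 (λ x y m x′ y′ →
    (:- m) :* x′ :+ con 1ℚ :* y′ :+ (m :* x :- y) := (y′ :- y) :- m :* (x′ :- x)) refl x y m x′ y′

  eval-above-base : ∀ p m → eval (above p m) p ≡ 0ℚ
  eval-above-base (x , y) m = solve 3 (λ x y m → (:- m) :* x :+ con 1ℚ :* y :+ (m :* x :- y) := con 0ℚ) refl x y m

  slope : Point → Point → ℚ
  slope (x , y) (x′ , y′) with x′ - x ℚₚ.≟ 0ℚ
  -- An arbitrary default: the ends of an edge in a `Drawing` have different abscissae.
  ... | yes _ = 0ℚ
  ... | no x′-x≢0 = (y′ - y) * (1/_ (x′ - x) {{≢-nonZero x′-x≢0}})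

  -- With y-coefficient 1, a positive value means "above" whichever end is named first.
  chord : Point → Point → Affine
  chord p q = above p (slope p q)

  eval-chord-end : ∀ p q → proj₁ p ≢ proj₁ q → eval (chord p q) q ≡ 0ℚ
  eval-chord-end p@(x , y) q@(x′ , y′) x≢x′ with x′ - x ℚₚ.≟ 0ℚ
  ... | yes x′-x≡0 = contradiction
    (trans (sym (ℚₚ.+-identityˡ x)) (trans (cong (_+ x) (sym x′-x≡0)) (solve 2 (λ x x′ → x′ :- x :+ x := x′) refl x x′)))
    x≢x′
  ... | no x′-x≢0 = trans (eval-above p ((y′ - y) * w⁻¹) q) (trans
    (solve 3 (λ h e w → h :- h :* e :* w := h :* (con 1ℚ :- e :* w)) refl (y′ - y) w⁻¹ (x′ - x))
    (trans (cong (λ z → (y′ - y) * (1ℚ - z)) (ℚₚ.*-inverseˡ (x′ - x) {{≢-nonZero x′-x≢0}})) (ℚₚ.*-zeroʳ (y′ - y))))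
    where w⁻¹ = 1/_ (x′ - x) {{≢-nonZero x′-x≢0}}

  edgeChord : (Fin n → Point) → Fin n × Fin n → Affine
  edgeChord pos (a , b) = chord (pos a) (pos b)

  On : (Fin n → Point) → Point → Fin n × Fin n → Set
  On pos z (a , b) = OnSegment z (pos a) (pos b)

  _isEndOf_ : Fin n → Fin n × Fin n → Set
  c isEndOf (a , b) = c ≡ a ⊎ c ≡ b

  Clear : (Fin n → Point) → Fin n × Fin n → Set
  Clear pos e = ∀ c → On pos (pos c) e → c isEndOf e

  NonCrossing : (Fin n → Point) → Fin n × Fin n → Fin n × Fin n → Set
  NonCrossing pos e f = ∀ z → On pos z e → On pos z f → ∃ λ a → a isEndOf e × a isEndOf f × z ≡ pos a

  -- Distinct abscissae keep every edge non-vertical.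
  record Drawing (pos : Fin n → Point) (R : Graph n) : Set where
    field
      X-injective : ∀ {a b} → X pos a ≡ X pos b → a ≡ b
      loopless    : All (λ (a , b) → a ≢ b) R
      clear       : All (Clear pos) R
      noncrossing : AllPairs (NonCrossing pos) R

  -- No edge passes above the vertex u.
  Exposed : (Fin n → Point) → Fin n → Fin n × Fin n → Set
  Exposed pos u e@(a , b) =
    (X pos a ℚ.≤ X pos u × X pos b ℚ.≤ X pos u) ⊎
    (X pos u ℚ.≤ X pos a × X pos u ℚ.≤ X pos b) ⊎
    0ℚ ℚ.≤ eval (edgeChord pos e) (pos u)

  Visible : (Fin n → Point) → Graph n → Fin n → Set
  Visible pos R u = All (Exposed pos u) R

  Separator : (Fin n → Point) → Fin n → Point → (Fin n → Set) → Set
  Separator pos u w P = Σ[ L ∈ Affine ]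
    (∀ c → P c → eval L (pos c) ℚ.≤ 0ℚ) × 0ℚ ℚ.≤ eval L (pos u) × 0ℚ < eval L w

  -- Separators of u-w from the edges on either side of u; an edge passing below u is separated
  -- from u-w by its own line.
  record Sees (pos : Fin n → Point) (u : Fin n) (w : Point) : Set where
    field
      left  : Separator pos u w (λ c → X pos c ℚ.≤ X pos u)
      right : Separator pos u w (λ c → X pos u ℚ.≤ X pos c)

  -- By convexity the edge lies where `L` is at most 0, and the segment from `u` to `w` can touch
  -- that half-plane only at `u`.
  separated : ∀ {P u w a b z} → Separator pos u w P → P a → P b →
    OnSegment z (pos a) (pos b) → OnSegment z (pos u) w → z ≡ pos u
  separated {pos = pos} {u = u} {w} {a} {b} {z} (L , L≤0 , 0≤Lu , 0<Lw) Pa Pb on-ab on-uw =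
    segment-start L z (pos u) w on-uw 0≤Lu 0<Lw
      (eval-segment-≤ L z (pos a) (pos b) on-ab (L≤0 a Pa) (L≤0 b Pb))

  edge-separated : ∀ {u w a b z} → Sees pos u w → X pos a ≢ X pos b →
    Exposed pos u (a , b) → 0ℚ < eval (edgeChord pos (a , b)) w →
    OnSegment z (pos a) (pos b) → OnSegment z (pos u) w → z ≡ pos u
  edge-separated sees _ (inj₁ (a≤u , b≤u)) _ = separated (Sees.left sees) a≤u b≤u
  edge-separated sees _ (inj₂ (inj₁ (u≤a , u≤b))) _ = separated (Sees.right sees) u≤a u≤b
  edge-separated {pos = pos} {u = u} {w} {a} {b} sees a≢b (inj₂ (inj₂ 0≤Lu)) 0<Lw =
    separated {pos = pos} {P = λ c → c ≡ a ⊎ c ≡ b} {u = u} {w}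
      (chord (pos a) (pos b) , on-chord , 0≤Lu , 0<Lw) (inj₁ refl) (inj₂ refl)
    where
    on-chord : ∀ c → c ≡ a ⊎ c ≡ b → eval (chord (pos a) (pos b)) (pos c) ℚ.≤ 0ℚ
    on-chord c (inj₁ refl) = ℚₚ.≤-reflexive (eval-above-base (pos a) (slope (pos a) (pos b)))
    on-chord c (inj₂ refl) = ℚₚ.≤-reflexive (eval-chord-end (pos a) (pos b) a≢b)

  vertex-separated : ∀ {u w c} → Sees pos u w → OnSegment (pos c) (pos u) w → pos c ≡ pos u
  vertex-separated {pos = pos} {u = u} {c = c} sees on with ℚₚ.≤-total (X pos c) (X pos u)
  -- The vertex is treated as a degenerate edge from `c` to `c`.
  ... | inj₁ c≤u = separated (Sees.left sees) c≤u c≤u (segment-refl (pos c)) on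
  ... | inj₂ u≤c = separated (Sees.right sees) u≤c u≤c (segment-refl (pos c)) on

  infixr 5 _◂_
  _◂_ : Point → (Fin n → Point) → Fin (suc n) → Point
  (w ◂ pos) zero = w
  (w ◂ pos) (suc c) = pos c

  lift-end : ∀ {c} {e : Fin n × Fin n} → c isEndOf e → suc c isEndOf both suc e
  lift-end = Sum.map (cong suc) (cong suc)

  module _ {n} {pos : Fin n → Point} {R : Graph n} (drawing : Drawing pos R)
    {w : Point} (w-fresh : ∀ c → X pos c ≢ proj₁ w) (w-high : All (λ e → 0ℚ < eval (edgeChord pos e) w) R) where
    open Drawing drawing

    -- Also used alone, for the middle vertex of a series composition, which has no edges when it is
    -- placed.
    add-vertex : Drawing (w ◂ pos) (lift R)
    add-vertex = record
      { X-injective = λ {a} {b} → injective a b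
      ; loopless = Allₚ.map⁺ (All.map (λ a≢b → a≢b ∘ suc-injective) loopless)
      ; clear = Allₚ.map⁺ (All.zipWith (λ (a≢b , clear , high) → still-clear a≢b high clear) (loopless , All.zip (clear , w-high)))
      ; noncrossing = AllPairsₚ.map⁺ (AllPairs.map (λ nc z on-e on-f →
          Prod.map suc (Prod.map lift-end (Prod.map lift-end id)) (nc z on-e on-f)) noncrossing)
      }
      where
      injective : ∀ a b → X (w ◂ pos) a ≡ X (w ◂ pos) b → a ≡ b
      injective zero zero _ = refl
      injective zero (suc b) eq = contradiction (sym eq) (w-fresh b)
      injective (suc a) zero eq = contradiction eq (w-fresh a)
      injective (suc a) (suc b) eq = cong suc (X-injective eq)
      still-clear : ∀ {a b} → a ≢ b → 0ℚ < eval (edgeChord pos (a , b)) w →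
        Clear pos (a , b) → Clear (w ◂ pos) (suc a , suc b)
      still-clear {a} {b} a≢b high clear zero on = contradiction
        (ℚₚ.<-≤-trans high (eval-segment-≤ (chord (pos a) (pos b)) w (pos a) (pos b) on
          (ℚₚ.≤-reflexive (eval-above-base (pos a) (slope (pos a) (pos b))))
          (ℚₚ.≤-reflexive (eval-chord-end (pos a) (pos b) (a≢b ∘ X-injective)))))
        (ℚₚ.<-irrefl refl)
      still-clear _ _ clear (suc c) on = lift-end (clear c on)

    visible-new : Visible (w ◂ pos) (lift R) zero
    visible-new = Allₚ.map⁺ (All.map (λ high → inj₂ (inj₂ (ℚₚ.<⇒≤ high))) w-high)

    visible-old : ∀ {c} → Visible pos R c → Visible (w ◂ pos) (lift R) (suc c)
    visible-old vis = Allₚ.map⁺ vis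

    edge-clear : ∀ {u} → Sees pos u w → Clear (w ◂ pos) (suc u , zero)
    edge-clear sees zero on = inj₂ refl
    edge-clear {u} sees (suc c) on = inj₁ (cong suc (X-injective (cong proj₁ (vertex-separated {pos = pos} {u = u} {c = c} sees on))))

    edge-noncrossing : ∀ {u} → Sees pos u w → Visible pos R u → All (NonCrossing (w ◂ pos) (suc u , zero)) (lift R)
    edge-noncrossing {u} sees vis = Allₚ.map⁺ (All.zipWith meet (All.zip (loopless , clear) , All.zip (vis , w-high)))
      where
      meet : ∀ {e} → (((proj₁ e ≢ proj₂ e) × Clear pos e) × (Exposed pos u e × 0ℚ < eval (edgeChord pos e) w)) →
        NonCrossing (w ◂ pos) (suc u , zero) (both suc e)
      meet {a , b} ((a≢b , clear) , (exposed , high)) z on-new on-e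
        with edge-separated {pos = pos} {a = a} {b} {z} sees (a≢b ∘ X-injective) exposed high on-e on-new
      ... | refl = suc u , inj₁ refl , lift-end (clear u on-e) , refl

    module _ {u v : Fin n} (u<w : X pos u < proj₁ w) (w<v : proj₁ w < X pos v) where

      -- The vertical line through `w` has one edge on each side.
      apex : NonCrossing (w ◂ pos) (suc u , zero) (suc v , zero)
      apex z on-u on-v = zero , inj₂ refl , inj₂ refl ,
        segment-start L z w (pos u) (segment-sym z (pos u) w on-u)
          (ℚₚ.≤-reflexive (sym Lw≡0))
          (subst (0ℚ <_) (sym (eval-leftOf (proj₁ w) (pos u))) (<⇒0<- u<w))
          (eval-segment-≤ L z (pos v) w on-v
            (subst (ℚ._≤ 0ℚ) (sym (eval-leftOf (proj₁ w) (pos v))) (≤⇒-≤0 (ℚₚ.<⇒≤ w<v)))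
            (ℚₚ.≤-reflexive Lw≡0))
        where
        L = leftOf (proj₁ w)
        Lw≡0 : eval L w ≡ 0ℚ
        Lw≡0 = trans (eval-leftOf (proj₁ w) w) (ℚₚ.+-inverseʳ (proj₁ w))

      add-cherry : Sees pos u w → Sees pos v w → Visible pos R u → Visible pos R v → Drawing (w ◂ pos) (cherry u v R)
      add-cherry sees-u sees-v vis-u vis-v = record
        { X-injective = Drawing.X-injective add-vertex
        ; loopless = (λ ()) ∷ (λ ()) ∷ Drawing.loopless add-vertex
        ; clear = edge-clear sees-u ∷ edge-clear sees-v ∷ Drawing.clear add-vertex
        ; noncrossing = (apex ∷ edge-noncrossing sees-u vis-u) ∷ edge-noncrossing sees-v vis-v ∷ Drawing.noncrossing add-vertex
        }

      -- Both new edges stay within the strip between `u` and `v`, so they pass over no vertex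
      -- outside its interior.
      visible-cherry : ∀ {c} → X pos c ℚ.≤ X pos u ⊎ X pos v ℚ.≤ X pos c → Visible pos R c → Visible (w ◂ pos) (cherry u v R) (suc c)
      visible-cherry (inj₁ c≤u) vis =
        inj₂ (inj₁ (c≤u , c≤w)) ∷ inj₂ (inj₁ (ℚₚ.≤-trans c≤w (ℚₚ.<⇒≤ w<v) , c≤w)) ∷ visible-old vis
        where c≤w = ℚₚ.≤-trans c≤u (ℚₚ.<⇒≤ u<w)
      visible-cherry (inj₂ v≤c) vis =
        inj₁ (ℚₚ.≤-trans (ℚₚ.<⇒≤ u<w) w≤c , w≤c) ∷ inj₁ (v≤c , w≤c) ∷ visible-old vis
        where w≤c = ℚₚ.≤-trans (ℚₚ.<⇒≤ w<v) v≤c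

  -- Placing a new vertex and drawing networks

  record Apex (pos : Fin n → Point) (R : Graph n) (u v : Fin n) : Set where
    field
      point  : Point
      u<     : X pos u < proj₁ point
      <v     : proj₁ point < X pos v
      new    : ∀ c → X pos c ≢ proj₁ point
      high   : All (λ e → 0ℚ < eval (edgeChord pos e) point) R
      sees-u : Sees pos u point
      sees-v : Sees pos v point

  eventually-above : ∀ p m x → Eventually (λ y → 0ℚ < eval (above p m) (x , y))
  eventually-above p m x = 1ℚ + h , λ {l} k≤l → subst (0ℚ <_) (sym (trans (eval-above p m (x , l)) (eq l)))
    (<⇒0<- (ℚₚ.<-≤-trans (subst (_< 1ℚ + h) (ℚₚ.+-identityˡ h) (ℚₚ.+-monoˡ-< h 0<1)) k≤l))
    where
    -- The height of the line over `x`; one more is strictly above it.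
    h = proj₂ p + m * (x - proj₁ p)
    0<1 : 0ℚ < 1ℚ
    0<1 = ℚₚ.positive⁻¹ 1ℚ
    eq : ∀ l → (l - proj₂ p) - m * (x - proj₁ p) ≡ l - h
    eq l = solve 4 (λ l y m d → (l :- y) :- m :* d := l :- (y :+ m :* d)) refl l (proj₂ p) m (x - proj₁ p)

  -- Once the abscissa and two steep slopes are fixed, every remaining condition bounds the height
  -- from below. On the far side of each terminal the separator is vertical; on the side of the new
  -- vertex it is a steep line through the terminal.
  find-apex : ∀ {u v} → Drawing pos R → X pos u < X pos v → Apex pos R u v
  find-apex {pos = pos} {R = R} {u} {v} drawing u<v with fresh (X pos) u<v
  ... | x , u<x , x<v , avoids = record
    { point = x , y
    ; u< = u<x
    ; <v = x<v
    ; new = λ c eq → Sum.[ (λ c≤u → ℚₚ.<-irrefl eq (ℚₚ.≤-<-trans c≤u u<x)) , (λ x<c → ℚₚ.<-irrefl (sym eq) x<c) ] (avoids c)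
    ; high = proj₁ bounds
    ; sees-u = record
      { left = rightOf (X pos u) ,
          (λ c c≤u → subst (ℚ._≤ 0ℚ) (sym (eval-rightOf (X pos u) (pos c))) (≤⇒-≤0 c≤u)) ,
          subst (0ℚ ℚ.≤_) (sym (eval-rightOf (X pos u) (pos u))) (≤⇒0≤- {X pos u} ℚₚ.≤-refl) ,
          subst (0ℚ <_) (sym (eval-rightOf (X pos u) (x , y))) (<⇒0<- u<x)
      ; right = above (pos u) (proj₁ steep-u) , proj₂ steep-u ℚₚ.≤-refl ,
          ℚₚ.≤-reflexive (sym (eval-above-base (pos u) (proj₁ steep-u))) , proj₁ (proj₂ bounds)
      }
    ; sees-v = record
      { left = above (pos v) (- proj₁ steep-v) , proj₂ steep-v ℚₚ.≤-refl ,
          ℚₚ.≤-reflexive (sym (eval-above-base (pos v) (- proj₁ steep-v))) , proj₂ (proj₂ bounds)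
      ; right = leftOf (X pos v) ,
          (λ c v≤c → subst (ℚ._≤ 0ℚ) (sym (eval-leftOf (X pos v) (pos c))) (≤⇒-≤0 v≤c)) ,
          subst (0ℚ ℚ.≤_) (sym (eval-leftOf (X pos v) (pos v))) (≤⇒0≤- {X pos v} ℚₚ.≤-refl) ,
          subst (0ℚ <_) (sym (eval-leftOf (X pos v) (x , y))) (<⇒0<- x<v)
      }
    }
    where
    open Drawing drawing using (X-injective)
    -- A slope at least that of every line from `u` to a vertex on its right.
    steep-u : Eventually (λ k → ∀ c → X pos u ℚ.≤ X pos c → eval (above (pos u) k) (pos c) ℚ.≤ 0ℚ)
    steep-u = eventually-∀ steep
      where
      steep : ∀ c → Eventually (λ k → X pos u ℚ.≤ X pos c → eval (above (pos u) k) (pos c) ℚ.≤ 0ℚ)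
      steep c with ℚₚ.<-cmp (X pos u) (X pos c)
      ... | tri< u<c _ _ = eventually-map
        (λ {k} h _ → subst (ℚ._≤ 0ℚ) (sym (trans (eval-above (pos u) k (pos c))
          (cong (_-_ (proj₂ (pos c) - proj₂ (pos u))) (ℚₚ.*-comm k (X pos c - X pos u))))) (≤⇒-≤0 h))
        (eventually-≤* (proj₂ (pos c) - proj₂ (pos u)) (<⇒0<- u<c))
      ... | tri≈ _ u≡c _ rewrite X-injective u≡c = 0ℚ , λ {k} _ _ → ℚₚ.≤-reflexive (eval-above-base (pos c) k)
      ... | tri> u≮c _ c<u = 0ℚ , λ _ u≤c → contradiction (ℚₚ.<-≤-trans c<u u≤c) (ℚₚ.<-irrefl refl)
    -- The mirror image at `v`, hence the negated slope.
    steep-v : Eventually (λ k → ∀ c → X pos c ℚ.≤ X pos v → eval (above (pos v) (- k)) (pos c) ℚ.≤ 0ℚ)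
    steep-v = eventually-∀ steep
      where
      steep : ∀ c → Eventually (λ k → X pos c ℚ.≤ X pos v → eval (above (pos v) (- k)) (pos c) ℚ.≤ 0ℚ)
      steep c with ℚₚ.<-cmp (X pos c) (X pos v)
      ... | tri< c<v _ _ = eventually-map
        (λ {k} h _ → subst (ℚ._≤ 0ℚ) (sym (trans (eval-above (pos v) (- k) (pos c))
          (solve 4 (λ h k c v → h :- (:- k) :* (c :- v) := h :- (v :- c) :* k) refl
            (proj₂ (pos c) - proj₂ (pos v)) k (X pos c) (X pos v)))) (≤⇒-≤0 h))
        (eventually-≤* (proj₂ (pos c) - proj₂ (pos v)) (<⇒0<- c<v))
      ... | tri≈ _ c≡v _ rewrite X-injective c≡v = 0ℚ , λ {k} _ _ → ℚₚ.≤-reflexive (eval-above-base (pos v) (- k))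
      ... | tri> _ _ v<c = 0ℚ , λ _ c≤v → contradiction (ℚₚ.<-≤-trans v<c c≤v) (ℚₚ.<-irrefl refl)
    everything : Eventually (λ y → All (λ e → 0ℚ < eval (edgeChord pos e) (x , y)) R ×
      0ℚ < eval (above (pos u) (proj₁ steep-u)) (x , y) × 0ℚ < eval (above (pos v) (- proj₁ steep-v)) (x , y))
    everything = eventually-× (eventually-All (All.universal (λ (a , b) → eventually-above (pos a) (slope (pos a) (pos b)) x) R))
      (eventually-× (eventually-above (pos u) (proj₁ steep-u) x) (eventually-above (pos v) (- proj₁ steep-v) x))
    y = proj₁ everything
    bounds = proj₂ everything ℚₚ.≤-refl

  -- The non-strict inequalities in `visible` include `u` and `v`, so further networks can be drawn
  -- between the same terminals.
  record Redrawing (pos : Fin n → Point) (R : Graph n) (u v : Fin n) {k} (emb : Fin n → Fin k) (S : Graph k) : Set where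
    field
      pos′    : Fin k → Point
      fixed   : ∀ c → pos′ (emb c) ≡ pos c
      drawing : Drawing pos′ S
      visible : ∀ {c} → X pos c ℚ.≤ X pos u ⊎ X pos v ℚ.≤ X pos c → Visible pos R c → Visible pos′ S (emb c)

    fixed-< : ∀ {a b} → X pos a < X pos b → X pos′ (emb a) < X pos′ (emb b)
    fixed-< {a} {b} = subst₂ _<_ (sym (cong proj₁ (fixed a))) (sym (cong proj₁ (fixed b)))

    fixed-≤ : ∀ {a b} → X pos a ℚ.≤ X pos b → X pos′ (emb a) ℚ.≤ X pos′ (emb b)
    fixed-≤ {a} {b} = subst₂ ℚ._≤_ (sym (cong proj₁ (fixed a))) (sym (cong proj₁ (fixed b)))

  insert-drawing : ∀ p {u v : Fin n} → Drawing pos R → X pos u < X pos v →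
    Visible pos R u → Visible pos R v → Redrawing pos R u v (emb p) (insert p u v R)
  insert-drawing {pos = pos} leaf drawing u<v vis-u vis-v = record
    { pos′ = point ◂ pos
    ; fixed = λ c → refl
    ; drawing = add-cherry drawing {w = point} new high u< <v sees-u sees-v vis-u vis-v
    ; visible = visible-cherry drawing {w = point} new high u< <v
    }
    where open Apex (find-apex drawing u<v)
  insert-drawing {pos = pos} {R = R} (ser p q) {u} {v} drawing u<v vis-u vis-v = record
    { pos′ = P.pos′
    ; fixed = λ c → trans (P.fixed (emb q (suc c))) (Q.fixed (suc c))
    ; drawing = P.drawing
    ; visible = λ
      { (inj₁ c≤u) vis → P.visible (inj₁ (Q.fixed-≤ c≤u))
          (Q.visible (inj₁ (ℚₚ.≤-trans c≤u (ℚₚ.<⇒≤ u<))) (visible-old drawing {w = point} new high vis))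
      ; (inj₂ v≤c) vis → P.visible (inj₂ (Q.fixed-≤ (ℚₚ.≤-trans (ℚₚ.<⇒≤ <v) v≤c)))
          (Q.visible (inj₂ v≤c) (visible-old drawing {w = point} new high vis)) }
    }
    where
    open Apex (find-apex drawing u<v)
    -- The middle vertex comes first. Drawing `q` to its right hides neither it nor `u`, so `p` can
    -- follow on its left.
    module Q = Redrawing (insert-drawing q {zero} {suc v} (add-vertex drawing {w = point} new high) <v
      (visible-new drawing {w = point} new high) (visible-old drawing {w = point} new high vis-v))
    module P = Redrawing (insert-drawing p {emb q (suc u)} {emb q zero} Q.drawing (Q.fixed-< u<)
      (Q.visible (inj₁ (ℚₚ.<⇒≤ u<)) (visible-old drawing {w = point} new high vis-u))
      (Q.visible (inj₁ ℚₚ.≤-refl) (visible-new drawing {w = point} new high)))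
  insert-drawing (par p q) {u} {v} drawing u<v vis-u vis-v = record
    { pos′ = P.pos′
    ; fixed = λ c → trans (P.fixed (emb q c)) (Q.fixed c)
    ; drawing = P.drawing
    ; visible = λ outside vis → P.visible (Sum.map Q.fixed-≤ Q.fixed-≤ outside) (Q.visible outside vis)
    }
    where
    module Q = Redrawing (insert-drawing q {u} {v} drawing u<v vis-u vis-v)
    module P = Redrawing (insert-drawing p {emb q u} {emb q v} Q.drawing (Q.fixed-< u<v)
      (Q.visible (inj₁ ℚₚ.≤-refl) vis-u) (Q.visible (inj₂ ℚₚ.≤-refl) vis-v))

module Conductance where

  open Counting
  open import Data.Nat as ℕ using (ℕ; zero; suc; _+_; _*_; _≤_; z≤n; s≤s)
  import Data.Nat.Properties as ℕₚ
  open import Data.Nat.Tactic.RingSolver using (solve-∀)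
  open import Data.Integer as ℤ using (+_; +[1+_])
  import Data.Integer.Properties as ℤₚ
  open import Data.Rational as ℚ using (ℚ; mkℚ; Positive; toℚᵘ)
  import Data.Rational.Properties as ℚₚ
  open import Data.Rational.Unnormalised as ℚᵘ using (mkℚᵘ; *≡*)
  import Data.Rational.Unnormalised.Properties as ℚᵘₚ
  open import Data.Rational.Solver using (module +-*-Solver)
  open import Data.Fin using (Fin; zero; suc)
  open import Data.List using (List; []; _∷_; length)
  open import Data.List.Properties using (length-map)
  open import Data.List.Relation.Unary.All as LAll using ([]; _∷_)
  open import Data.Vec using (Vec; []; _∷_; lookup; tabulate)
  open import Data.Vec.Relation.Unary.All using (All; []; _∷_)
  open import Data.Product using (Σ-syntax; _×_; proj₁; proj₂; _,_)
  open import Relation.Nullary using (contradiction)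
  open import Relation.Binary.PropositionalEquality using (_≡_; refl; sym; trans; cong; cong₂; subst; module ≡-Reasoning)
  open import Function using (_∘_)

  private variable
    n : ℕ

  -- Networks from the Euclidean algorithm

  size : Net → ℕ
  size leaf = 2
  size (ser p q) = size p + size q
  size (par p q) = size p + size q

  length-insert : ∀ p {u v : Fin n} {R} → length (insert p u v R) ≡ size p + length R
  length-insert leaf {R = R} = cong (λ k → suc (suc k)) (length-map _ R)
  length-insert (ser p q) {R = R} = trans (length-insert p)
    (trans (cong (_+_ (size p)) (trans (length-insert q) (cong (_+_ (size q)) (length-map _ R))))
      (sym (ℕₚ.+-assoc (size p) (size q) (length R))))
  length-insert (par p q) {R = R} = trans (length-insert p)
    (trans (cong (_+_ (size p)) (length-insert q)) (sym (ℕₚ.+-assoc (size p) (size q) (length R))))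

  trees>0 : ∀ p → 1 ≤ trees p
  forests>0 : ∀ p → 1 ≤ forests p
  trees>0 leaf = s≤s z≤n
  trees>0 (ser p q) = ℕₚ.*-mono-≤ (trees>0 p) (trees>0 q)
  trees>0 (par p q) = ℕₚ.≤-trans (ℕₚ.*-mono-≤ (trees>0 p) (forests>0 q)) (ℕₚ.m≤m+n _ _)
  forests>0 leaf = s≤s z≤n
  forests>0 (ser p q) = ℕₚ.≤-trans (ℕₚ.*-mono-≤ (trees>0 p) (forests>0 q)) (ℕₚ.m≤m+n _ _)
  forests>0 (par p q) = ℕₚ.*-mono-≤ (forests>0 p) (forests>0 q)

  -- A four-cycle between opposite corners; its conductance is 1, as trees unit = forests unit = 4.
  unit : Net
  unit = par leaf leaf

  -- All facts about the fraction x/y are cross-multiplied, so that the Euclidean algorithm runs on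
  -- pairs of naturals.
  record Realisation (x y : ℕ) : Set where
    field
      cf     : ℕ × List ℕ
      parts  : LAll.All (1 ≤_) (proj₂ cf)
      value  : x * proj₂ (cfNumDen (proj₁ cf) (proj₂ cf)) ≡ proj₁ (cfNumDen (proj₁ cf) (proj₂ cf)) * y
      net    : Net
      cond   : trees net * y ≡ forests net * x
      size≡  : size net ≡ 4 * cfSum cf

  cfNumDen-suc : ∀ a as → let (p , r) = cfNumDen a as in cfNumDen (suc a) as ≡ (r + p , r)
  cfNumDen-suc a [] = refl
  cfNumDen-suc a (b ∷ bs) with cfNumDen b bs
  ... | p , r = cong (_, p) (ℕₚ.+-assoc p (a * p) r)

  realise-one : ∀ x → Realisation x x
  realise-one x = record
    { cf = 1 , []
    ; parts = []
    ; value = ℕₚ.*-comm x 1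
    ; net = unit
    ; cond = refl
    ; size≡ = refl
    }

  -- A parallel `unit` adds 1 to the conductance, as does raising the leading term of the continued
  -- fraction.
  realise-+ : ∀ {z y} → Realisation z y → Realisation (y + z) y
  realise-+ {z} {y} record { cf = a , as ; parts = parts ; value = value ; net = p ; cond = cond ; size≡ = size≡ } = record
    { cf = suc a , as
    ; parts = parts
    ; value = subst (λ (N , D) → (y + z) * D ≡ N * y) (sym (cfNumDen-suc a as))
        (numerator y z (proj₂ (cfNumDen a as)) (proj₁ (cfNumDen a as)) value)
    ; net = par unit p
    ; cond = network y z (trees p) (forests p) cond
    ; size≡ = trans (cong (_+_ 4) size≡) (sym (ℕₚ.*-distribˡ-+ 4 1 (cfSum (a , as))))
    }
    where
    numerator : ∀ y z D N → z * D ≡ N * y → (y + z) * D ≡ (D + N) * y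
    numerator y z D N eq = trans (ℕₚ.*-distribʳ-+ D y z) (trans (cong₂ _+_ (ℕₚ.*-comm y D) eq) (sym (ℕₚ.*-distribʳ-+ y D N)))
    expand : ∀ y T F → (4 * F + 4 * T) * y ≡ 4 * (F * y) + 4 * (T * y)
    expand = solve-∀
    collect : ∀ y z F → 4 * (F * y) + 4 * (F * z) ≡ (4 * F) * (y + z)
    collect = solve-∀
    network : ∀ y z T F → T * y ≡ F * z → (4 * F + 4 * T) * y ≡ (4 * F) * (y + z)
    network y z T F eq = trans (expand y T F) (trans (cong (λ w → 4 * (F * y) + 4 * w) eq) (collect y z F))

  -- A `unit` in series adds 1 to the resistance, taking z/x to 1 + z/x.
  realise-reciprocal : ∀ {x z} → 1 ≤ x → Realisation x z → Realisation x (x + z)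
  realise-reciprocal {x} {z} 1≤x record { cf = cf ; parts = parts ; value = value ; net = p ; cond = cond ; size≡ = size≡ } =
    build cf parts value size≡
    where
    numerator : ∀ N D → x * D ≡ N * z → x * (N + D) ≡ N * (x + z)
    numerator N D eq = trans (ℕₚ.*-distribˡ-+ x N D) (trans (cong₂ _+_ (ℕₚ.*-comm x N) eq) (sym (ℕₚ.*-distribˡ-+ N x z)))
    expand : ∀ x z T → (4 * T) * (x + z) ≡ 4 * (T * z) + 4 * (T * x)
    expand = solve-∀
    collect : ∀ x T F → 4 * (F * x) + 4 * (T * x) ≡ (4 * F + 4 * T) * x
    collect = solve-∀
    network : (4 * trees p) * (x + z) ≡ (4 * forests p + 4 * trees p) * x
    network = trans (expand x z (trees p))
      (trans (cong (λ w → 4 * w + 4 * (trees p * x)) cond) (collect x (trees p) (forests p)))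
    build : ∀ cf → LAll.All (1 ≤_) (proj₂ cf) →
      x * proj₂ (cfNumDen (proj₁ cf) (proj₂ cf)) ≡ proj₁ (cfNumDen (proj₁ cf) (proj₂ cf)) * z →
      size p ≡ 4 * cfSum cf → Realisation x (x + z)
    -- This continued fraction is 0, whereas `x` is positive.
    build (zero , []) _ value _ = contradiction (trans (sym (ℕₚ.*-identityʳ x)) value) (λ { refl → ℕₚ.1+n≰n 1≤x })
    build (zero , b ∷ bs) (_ ∷ parts) value size≡ = record
      -- The reciprocal of [0; b, ...] is [b; ...]; adding 1 and inverting again raises b.
      { cf = 0 , suc b ∷ bs
      ; parts = s≤s z≤n ∷ parts
      ; value = subst (λ (N , D) → x * N ≡ D * (x + z)) (sym (cfNumDen-suc b bs))
          (numerator (proj₂ (cfNumDen b bs)) (proj₁ (cfNumDen b bs)) value)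
      ; net = ser unit p
      ; cond = network
      ; size≡ = trans (cong (_+_ 4) size≡) (sym (ℕₚ.*-distribˡ-+ 4 1 (cfSum (0 , b ∷ bs))))
      }
    build (suc a , as) parts value size≡ = record
      -- With a nonzero leading term the reciprocal starts with 0; adding 1 turns that into a new
      -- term 1, and inverting puts 0 in front.
      { cf = 0 , 1 ∷ suc a ∷ as
      ; parts = s≤s z≤n ∷ s≤s z≤n ∷ parts
      ; value = subst (λ w → x * (w + proj₂ (cfNumDen (suc a) as)) ≡ proj₁ (cfNumDen (suc a) as) * (x + z))
          (sym (ℕₚ.+-identityʳ _)) (numerator (proj₁ (cfNumDen (suc a) as)) (proj₂ (cfNumDen (suc a) as)) value)
      ; net = ser unit p
      ; cond = network
      ; size≡ = trans (cong (_+_ 4) size≡) (sym (ℕₚ.*-distribˡ-+ 4 1 (cfSum (suc a , as))))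
      }

  shorten : ∀ x k → suc x + suc k ≤ x + suc (suc (x + k))
  shorten x k = subst (_≤ x + suc (suc (x + k))) (ℕₚ.+-suc x (suc k))
    (ℕₚ.+-monoʳ-≤ x (s≤s (s≤s (ℕₚ.m≤n+m k x))))

  -- Euclid by subtraction: each step, the final one included, costs one `unit` and adds 1 to
  -- `cfSum`. The fuel bounds the sum of the pair, which each subtraction lowers.
  realise : ∀ fuel x y → suc x + suc y ≤ fuel → Realisation (suc x) (suc y)
  realise (suc fuel) x y (s≤s x+y≤fuel) with ℕ.compare x y
  ... | ℕ.equal _ = realise-one (suc x)
  ... | ℕ.less x k = subst (λ w → Realisation (suc x) (suc w)) (ℕₚ.+-suc x k)
    (realise-reciprocal (s≤s z≤n) (realise fuel x k (ℕₚ.≤-trans (shorten x k) x+y≤fuel)))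
  ... | ℕ.greater y k = subst (λ w → Realisation (suc w) (suc y)) (ℕₚ.+-suc y k)
    (realise-+ (realise fuel k y (ℕₚ.≤-trans (ℕₚ.+-monoˡ-≤ (suc y) (s≤s (ℕₚ.m≤n+m k y))) x+y≤fuel)))

  -- Conductance as a rational number

  ι : ℕ → ℚ
  ι n = + n ℚ./ 1

  ι-toℚᵘ : ∀ n → toℚᵘ (ι n) ℚᵘ.≃ mkℚᵘ (+ n) 0
  ι-toℚᵘ n = ℚₚ.toℚᵘ-fromℚᵘ (mkℚᵘ (+ n) 0)

  ι-+ : ∀ m n → ι (m + n) ≡ ι m ℚ.+ ι n
  ι-+ m n = ℚₚ.toℚᵘ-injective (begin
    toℚᵘ (ι (m + n)) ≈⟨ ι-toℚᵘ (m + n) ⟩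
    mkℚᵘ (+ (m + n)) 0 ≈⟨ *≡* (cong (ℤ._* + 1) (sym (cong₂ ℤ._+_ (ℤₚ.*-identityʳ (+ m)) (ℤₚ.*-identityʳ (+ n))))) ⟩
    mkℚᵘ (+ m) 0 ℚᵘ.+ mkℚᵘ (+ n) 0 ≈⟨ ℚᵘₚ.+-cong (ι-toℚᵘ m) (ι-toℚᵘ n) ⟨
    toℚᵘ (ι m) ℚᵘ.+ toℚᵘ (ι n) ≈⟨ ℚₚ.toℚᵘ-homo-+ (ι m) (ι n) ⟨
    toℚᵘ (ι m ℚ.+ ι n) ∎)
    where open ℚᵘₚ.≃-Reasoning

  ι-* : ∀ m n → ι (m * n) ≡ ι m ℚ.* ι n
  ι-* m n = ℚₚ.toℚᵘ-injective (begin
    toℚᵘ (ι (m * n)) ≈⟨ ι-toℚᵘ (m * n) ⟩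
    mkℚᵘ (+ (m * n)) 0 ≈⟨ *≡* (cong (ℤ._* + 1) (ℤₚ.pos-* m n)) ⟩
    mkℚᵘ (+ m) 0 ℚᵘ.* mkℚᵘ (+ n) 0 ≈⟨ ℚᵘₚ.*-cong (ι-toℚᵘ m) (ι-toℚᵘ n) ⟨
    toℚᵘ (ι m) ℚᵘ.* toℚᵘ (ι n) ≈⟨ ℚₚ.toℚᵘ-homo-* (ι m) (ι n) ⟨
    toℚᵘ (ι m ℚ.* ι n) ∎)
    where open ℚᵘₚ.≃-Reasoning

  Conducts : Net → ℚ → Set
  Conducts p q = ι (trees p) ≡ ι (forests p) ℚ.* q

  conducts-fraction : ∀ p q {x} → ℚ.↥ q ≡ + x → trees p * ℚ.↧ₙ q ≡ forests p * x → Conducts p q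
  conducts-fraction p q@(mkℚ _ d _) {x} refl eq = ℚₚ.toℚᵘ-injective (begin
    toℚᵘ (ι (trees p)) ≈⟨ ι-toℚᵘ (trees p) ⟩
    mkℚᵘ (+ trees p) 0 ≈⟨ *≡* cross ⟩
    mkℚᵘ (+ forests p) 0 ℚᵘ.* mkℚᵘ (+ x) d ≈⟨ ℚᵘₚ.*-cong (ι-toℚᵘ (forests p)) ℚᵘₚ.≃-refl ⟨
    toℚᵘ (ι (forests p)) ℚᵘ.* mkℚᵘ (+ x) d ≈⟨ ℚₚ.toℚᵘ-homo-* (ι (forests p)) q ⟨
    toℚᵘ (ι (forests p) ℚ.* q) ∎)
    where
    open ℚᵘₚ.≃-Reasoning
    cross : + trees p ℤ.* + (1 * suc d) ≡ (+ forests p ℤ.* + x) ℤ.* + 1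
    cross = trans (sym (ℤₚ.pos-* (trees p) (1 * suc d)))
      (trans (cong +_ (trans (cong (trees p *_) (ℕₚ.*-identityˡ (suc d))) eq))
        (trans (ℤₚ.pos-* (forests p) x) (sym (ℤₚ.*-identityʳ _))))

  conducts-par : ∀ p p′ {q q′} → Conducts p q → Conducts p′ q′ → Conducts (par p p′) (q ℚ.+ q′)
  conducts-par p p′ {q} {q′} cp cp′ = begin
    ι (trees p * forests p′ + forests p * trees p′)
      ≡⟨ trans (ι-+ (trees p * forests p′) _) (cong₂ ℚ._+_ (ι-* (trees p) _) (ι-* (forests p) _)) ⟩
    ι (trees p) ℚ.* ι (forests p′) ℚ.+ ι (forests p) ℚ.* ι (trees p′)
      ≡⟨ cong₂ (λ s t → s ℚ.* ι (forests p′) ℚ.+ ι (forests p) ℚ.* t) cp cp′ ⟩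
    (ι (forests p) ℚ.* q) ℚ.* ι (forests p′) ℚ.+ ι (forests p) ℚ.* (ι (forests p′) ℚ.* q′)
      ≡⟨ solve 4 (λ F F′ q q′ → (F :* q) :* F′ :+ F :* (F′ :* q′) := (F :* F′) :* (q :+ q′)) refl (ι (forests p)) (ι (forests p′)) q q′ ⟩
    (ι (forests p) ℚ.* ι (forests p′)) ℚ.* (q ℚ.+ q′)
      ≡⟨ cong (ℚ._* (q ℚ.+ q′)) (ι-* (forests p) (forests p′)) ⟨
    ι (forests p * forests p′) ℚ.* (q ℚ.+ q′) ∎
    where
    open ≡-Reasoning
    open +-*-Solver

  realiseℚ : ∀ q → Positive q →
    Σ[ cf ∈ ℕ × List ℕ ] Σ[ p ∈ Net ] IsCF q cf × Conducts p q × size p ≡ 4 * cfSum cf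
  realiseℚ q@(mkℚ +[1+ x ] d _) _ = cf , net , (parts , isValue) , conducts-fraction net q refl cond , size≡
    where
    open Realisation (realise _ x d ℕₚ.≤-refl)
    isValue : + suc x ℤ.* + proj₂ (cfNumDen (proj₁ cf) (proj₂ cf)) ≡ + proj₁ (cfNumDen (proj₁ cf) (proj₂ cf)) ℤ.* + suc d
    isValue = trans (sym (ℤₚ.pos-* (suc x) _)) (trans (cong +_ value) (ℤₚ.pos-* (proj₁ (cfNumDen (proj₁ cf) (proj₂ cf))) (suc d)))

  -- The induction starts from one number: every `Net` has positive conductance, so the empty sum
  -- has no network.
  realise-sum : ∀ {k} (q : Vec ℚ (suc k)) → All Positive q →
    Σ[ cf ∈ (Fin (suc k) → ℕ × List ℕ) ] Σ[ p ∈ Net ]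
      (∀ i → IsCF (lookup q i) (cf i)) × Conducts p (sumℚ q) × size p ≡ 4 * sumℕ (tabulate (cfSum ∘ cf))
  realise-sum (q ∷ []) (q>0 ∷ []) =
    let cf , p , isCF , conducts , size≡ = realiseℚ q q>0
    in (λ _ → cf) , p , (λ { zero → isCF }) , subst (Conducts p) (sym (ℚₚ.+-identityʳ q)) conducts ,
       trans size≡ (cong (4 *_) (sym (ℕₚ.+-identityʳ (cfSum cf))))
  realise-sum (q ∷ qs@(_ ∷ _)) (q>0 ∷ qs>0) =
    let cf , p , isCF , conducts , size≡ = realiseℚ q q>0
        cfs , p′ , isCFs , conducts′ , size′≡ = realise-sum qs qs>0
    in (λ { zero → cf ; (suc i) → cfs i }) , par p p′ , (λ { zero → isCF ; (suc i) → isCFs i }) ,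
       conducts-par p p′ conducts conducts′ ,
       trans (cong₂ _+_ size≡ size′≡) (sym (ℕₚ.*-distribˡ-+ 4 (cfSum cf) _))

module Assembly where

  open Counting
  open PlaneDrawings
  open Conductance
  open import Data.Nat using (ℕ; zero; suc; _*_; _+_)
  import Data.Nat.Properties as ℕₚ
  open import Data.Integer using (+_)
  open import Data.Rational as ℚ using (ℚ; Positive; 0ℚ; 1ℚ)
  import Data.Rational.Properties as ℚₚ
  open import Data.Fin using (Fin; zero; suc; punchIn)
  open import Data.Fin.Properties using (_≟_; suc-injective; punchOut-cong; punchOut-injective; punchOut-punchIn; punchInᵢ≢i)
  open import Data.Vec using (Vec; lookup; tabulate)
  open import Data.Vec.Relation.Unary.All using (All)
  open import Data.List as List using (List; []; _∷_; _++_; length; map)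
  open import Data.List.Properties using (map-++; filter-all; filter-reject)
  import Data.List.Relation.Unary.All as LAll
  open import Data.List.Relation.Unary.All using ([]; _∷_)
  import Data.List.Relation.Unary.All.Properties as LAllₚ
  open import Data.List.Relation.Unary.Any using (here)
  open import Data.List.Relation.Unary.AllPairs as AllPairs using (AllPairs; []; _∷_)
  import Data.List.Relation.Unary.AllPairs.Properties as AllPairsₚ
  open import Data.List.Relation.Binary.Permutation.Propositional using (_↭_; ↭-sym; ↭⇒↭ₛ)
  open import Data.List.Relation.Binary.Permutation.Propositional.Properties using (∷↭∷ʳ; All-resp-↭)
  import Data.List.Relation.Binary.Permutation.Setoid.Properties as Permutationₛ
  open import Data.List.Membership.Propositional.Properties using (∈-lookup)
  open import Data.Product as Prod using (Σ-syntax; _×_; proj₁; proj₂; _,_)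
  open import Data.Sum as Sum using (_⊎_; inj₁; inj₂)
  open import Relation.Nullary using (¬_; yes; no; contradiction; ¬?)
  open import Relation.Binary using (Symmetric)
  open import Relation.Binary.PropositionalEquality using (_≡_; _≢_; refl; sym; trans; cong; cong₂; subst; subst₂; setoid; resp₂)
  open import Relation.Binary.Construct.Closure.ReflexiveTransitive using (ε; _◅_)
  open import Relation.Binary.Construct.Closure.Symmetric using (fwd; bwd)
  import Relation.Binary.Construct.Closure.Equivalence as Eq
  open import Function using (_∘_; Equivalence)

  private variable
    n : ℕ

  -- Simplicity and the contraction of the statement

  emb-injective : ∀ p {x y : Fin n} → emb p x ≡ emb p y → x ≡ y
  emb-injective leaf = suc-injective
  emb-injective (ser p q) = suc-injective ∘ emb-injective q ∘ emb-injective p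
  emb-injective (par p q) = emb-injective q ∘ emb-injective p

  NotParallel : Fin n × Fin n → Fin n × Fin n → Set
  NotParallel (a , b) (c , d) = ¬ ((a ≡ c × b ≡ d) ⊎ (a ≡ d × b ≡ c))

  notParallel-sym : Symmetric (NotParallel {n})
  notParallel-sym np (inj₁ (refl , refl)) = np (inj₁ (refl , refl))
  notParallel-sym np (inj₂ (refl , refl)) = np (inj₂ (refl , refl))

  lift-notParallel : {R : Graph n} → AllPairs NotParallel R → AllPairs NotParallel (lift R)
  lift-notParallel = AllPairsₚ.map⁺ ∘ AllPairs.map λ np →
    np ∘ Sum.map (Prod.map suc-injective suc-injective) (Prod.map suc-injective suc-injective)

  -- Every edge is created at a fresh vertex, so only the two edges of one cherry could coincide,
  -- and their other ends differ.
  insert-notParallel : ∀ p {u v : Fin n} {R} → u ≢ v → AllPairs NotParallel R → AllPairs NotParallel (insert p u v R)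
  insert-notParallel leaf {R = R} u≢v nps =
    ((λ { (inj₁ (eq , _)) → u≢v (suc-injective eq) ; (inj₂ ()) }) ∷ new) ∷ new ∷ lift-notParallel nps
    where
    new : ∀ {w} → LAll.All (NotParallel (suc w , zero)) (lift R)
    new = LAllₚ.map⁺ (LAll.universal (λ _ → λ { (inj₁ ()) ; (inj₂ ()) }) R)
  insert-notParallel (ser p q) u≢v nps =
    insert-notParallel p ((λ ()) ∘ emb-injective q) (insert-notParallel q (λ ()) (lift-notParallel nps))
  insert-notParallel (par p q) u≢v nps =
    insert-notParallel p (u≢v ∘ emb-injective q) (insert-notParallel q u≢v nps)

  -- This reconciles drawing and counting: `e` is present from the start in the one and absent from
  -- `H` in the other.
  insert-++ : ∀ p {u v : Fin n} R S → insert p u v (R ++ S) ≡ insert p u v R ++ extend p S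
  insert-++ leaf R S = cong (λ T → _ ∷ _ ∷ T) (map-++ _ R S)
  insert-++ (ser p q) R S = trans
    (cong (insert p _ _) (trans (cong (insert q _ _) (map-++ _ R S)) (insert-++ q (lift R) (lift S))))
    (insert-++ p _ _)
  insert-++ (par p q) R S = trans (cong (insert p _ _) (insert-++ q R S)) (insert-++ p _ _)

  allPairs-lookup : ∀ {A : Set} {R : A → A → Set} → Symmetric R → ∀ {xs} → AllPairs R xs →
    ∀ i j → i ≢ j → R (List.lookup xs i) (List.lookup xs j)
  allPairs-lookup sym (r ∷ rs) zero zero i≢j = contradiction refl i≢j
  allPairs-lookup sym (r ∷ rs) zero (suc j) i≢j = LAll.lookup r (∈-lookup j)
  allPairs-lookup sym (r ∷ rs) (suc i) zero i≢j = sym (LAll.lookup r (∈-lookup i))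
  allPairs-lookup sym (r ∷ rs) (suc i) (suc j) i≢j = allPairs-lookup sym rs i j (i≢j ∘ cong suc)

  noncrossing-sym : ∀ {pos : Fin n → Point} → Symmetric (NonCrossing pos)
  noncrossing-sym nc z on-f on-e = let a , a∈e , a∈f , eq = nc z on-e on-f in a , a∈f , a∈e , eq

  planeDrawing : ∀ {pos : Fin n → Point} {G} → Drawing pos G → PlaneDrawing G pos
  planeDrawing {pos = pos} {G} drawing =
    (λ a b eq → X-injective (cong proj₁ eq)) ,
    (λ a e → LAll.lookup clear (∈-lookup e) a) ,
    (λ e f e≢f → allPairs-lookup (λ {e} {f} → noncrossing-sym {pos = pos} {e} {f}) noncrossing e f e≢f)
    where open Drawing drawing

  simple : ∀ {pos : Fin n → Point} {G} → Drawing pos G → AllPairs NotParallel G → Simple G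
  simple drawing nps =
    (λ e → LAll.lookup (Drawing.loopless drawing) (∈-lookup e)) ,
    allPairs-lookup notParallel-sym nps

  drawing-resp-↭ : ∀ {pos : Fin n → Point} {G H} → G ↭ H → Drawing pos G → Drawing pos H
  drawing-resp-↭ {pos = pos} G↭H drawing = record
    { X-injective = X-injective
    ; loopless = All-resp-↭ G↭H loopless
    ; clear = All-resp-↭ G↭H clear
    ; noncrossing = Permutationₛ.AllPairs-resp-↭ (setoid _) (λ {e} {f} → noncrossing-sym {pos = pos} {e} {f})
        (resp₂ _) (↭⇒↭ₛ G↭H) noncrossing
    }
    where open Drawing drawing

  merge-contracts : {s t : Fin (suc n)} (s≢t : s ≢ t) → Contracts (merge s t s≢t) s t
  merge-contracts {s = s} {t} s≢t = record
    { glues = glues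
    ; kernel = λ {x} {y} → kernel x y
    ; section = punchIn t
    ; isSection = isSection
    }
    where
    glues : merge s t s≢t s ≡ merge s t s≢t t
    glues with s ≟ t | t ≟ t
    ... | yes s≡t | _ = contradiction s≡t s≢t
    ... | no _ | yes _ = punchOut-cong t refl
    ... | no _ | no t≢t = contradiction refl t≢t
    kernel : ∀ x y → merge s t s≢t x ≡ merge s t s≢t y → Conn ((s , t) ∷ []) x y
    kernel x y eq with x ≟ t | y ≟ t
    ... | yes refl | yes refl = ε
    ... | yes refl | no y≢t = subst (Conn _ t) (punchOut-injective (s≢t ∘ sym) (y≢t ∘ sym) eq) (bwd (here refl) ◅ ε)
    ... | no x≢t | yes refl = subst (λ z → Conn _ z t) (sym (punchOut-injective (x≢t ∘ sym) (s≢t ∘ sym) eq)) (fwd (here refl) ◅ ε)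
    ... | no x≢t | no y≢t = subst (Conn _ x) (punchOut-injective (x≢t ∘ sym) (y≢t ∘ sym) eq) ε
    isSection : ∀ y → merge s t s≢t (punchIn t y) ≡ y
    isSection y with punchIn t y ≟ t
    ... | yes eq = contradiction eq (punchInᵢ≢i t y)
    ... | no _ = trans (punchOut-cong t refl) (punchOut-punchIn t)

  conn-[] : {x y : Fin n} → Conn [] x y → x ≡ y
  conn-[] ε = refl
  conn-[] (fwd () ◅ _)
  conn-[] (bwd () ◅ _)

  -- In a simple graph contraction turns only the contracted edge into a loop, so the filter removes
  -- nothing else.
  contract-first : ∀ {s t : Fin (suc n)} {H} (s≢t : s ≢ t) → LAll.All (λ (a , b) → a ≢ b) H →
    LAll.All (NotParallel (s , t)) H → contract ((s , t) ∷ H) zero s≢t ≡ image (merge s t s≢t) H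
  contract-first {s = s} {t} {H} s≢t loopless nps =
    trans (filter-reject nonLoop? (λ nonLoop → nonLoop glues))
      (filter-all nonLoop? (LAllₚ.map⁺ (LAll.zipWith still (loopless , nps))))
    where
    open Contracts (merge-contracts s≢t)
    nonLoop? = λ (p : Fin _ × Fin _) → ¬? (proj₁ p ≟ proj₂ p)
    still : ∀ {e} → proj₁ e ≢ proj₂ e × NotParallel (s , t) e → merge s t s≢t (proj₁ e) ≢ merge s t s≢t (proj₂ e)
    still (a≢b , np) eq with conn-∷⁻ (kernel eq)
    ... | inj₁ ab = a≢b (conn-[] ab)
    ... | inj₂ (inj₁ (as , tb)) = np (inj₁ (sym (conn-[] as) , conn-[] tb))
    ... | inj₂ (inj₂ (at , sb)) = np (inj₂ (conn-[] sb , sym (conn-[] at)))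

  -- The graph with its distinguished edge

  base : Graph 2
  base = (zero , suc zero) ∷ []

  base-pos : Fin 2 → Point
  base-pos zero = 0ℚ , 0ℚ
  base-pos (suc _) = 1ℚ , 0ℚ

  base-drawing : Drawing base-pos base
  base-drawing = record
    { X-injective = λ {a} {b} → injective a b
    ; loopless = (λ ()) ∷ []
    ; clear = (λ { zero _ → inj₁ refl ; (suc zero) _ → inj₂ refl }) ∷ []
    ; noncrossing = [] ∷ []
    }
    where
    injective : ∀ a b → X base-pos a ≡ X base-pos b → a ≡ b
    injective zero zero _ = refl
    injective (suc zero) (suc zero) _ = refl

  -- The order `ext p 2` is not visibly a successor; as a field it can be matched with `suc n`,
  -- which `contract` requires.
  record Realised (A B l : ℕ) : Set where
    field
      {order} : ℕ
      s t     : Fin order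
      H       : Graph order
      pos     : Fin order → Point
      drawing : Drawing pos ((s , t) ∷ H)
      nps     : AllPairs NotParallel ((s , t) ∷ H)
      deleted    : Count [] H A
      contracted : Count ((s , t) ∷ []) H B
      length-H   : length H ≡ l

  realised : ∀ p → Realised (trees p) (forests p) (size p)
  realised p = record
    { s = s
    ; t = t
    ; H = H
    ; pos = pos′
    ; drawing = drawing-resp-↭ e-first drawing
    ; nps = Permutationₛ.AllPairs-resp-↭ (setoid _) notParallel-sym (resp₂ _) (↭⇒↭ₛ e-first)
        (insert-notParallel p {R = base} (λ ()) ([] ∷ []))
    ; deleted = subst₂ (λ C k → Count C H k) (extend-[] p)
        (trans (cong₂ _+_ (ℕₚ.*-identityʳ (trees p)) (ℕₚ.*-zeroʳ (forests p))) (ℕₚ.+-identityʳ (trees p)))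
        -- Two bare terminals have one spanning tree when contracted and none otherwise, which
        -- leaves `trees p`.
        (count-insert p ((λ ()) ∘ conn-[]) (count-[] spans) (count-isolated {n = 1} zero {C = []} {G = []}))
    ; contracted = subst₂ (λ C k → Count C H k) extend-base (ℕₚ.*-identityʳ (forests p))
        (count-insert-closed p (Eq.return (here refl)) (count-[] spans))
    ; length-H = trans (length-insert p) (ℕₚ.+-identityʳ (size p))
    }
    where
    s = emb p zero
    t = emb p (suc zero)
    H = insert p zero (suc zero) []
    extend-base : extend p base ≡ (s , t) ∷ []
    extend-base = trans (extend-∷ p []) (cong ((s , t) ∷_) (extend-[] p))
    -- Insertion leaves `e` at the end of the list; at the front, deleting it computes to `H`.
    e-first : insert p zero (suc zero) base ↭ (s , t) ∷ H
    e-first = subst (_↭ (s , t) ∷ H)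
      (sym (trans (insert-++ p [] base) (cong (H ++_) extend-base))) (↭-sym (∷↭∷ʳ (s , t) H))
    -- The edge `e` is drawn below everything else, and each terminal is exposed as an extreme point
    -- of it.
    open Redrawing (insert-drawing p {zero} {suc zero} base-drawing (ℚₚ.positive⁻¹ 1ℚ)
      (inj₂ (inj₁ (ℚₚ.≤-refl , ℚₚ.nonNegative⁻¹ 1ℚ)) ∷ [])
      (inj₁ (ℚₚ.nonNegative⁻¹ 1ℚ , ℚₚ.≤-refl) ∷ []))
    spans : Spans base
    spans zero zero = ε
    spans zero (suc zero) = fwd (here refl) ◅ ε
    spans (suc zero) zero = bwd (here refl) ◅ ε
    spans (suc zero) (suc zero) = ε

  Conclusion : ∀ {k} → Vec ℚ k → Set
  Conclusion {k} q =
    Σ[ n ∈ ℕ ] Σ[ G ∈ Graph (suc n) ] Σ[ s ∈ Simple G ] (Planar G ×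
    Σ[ e ∈ Edge G ] Σ[ t₁ ∈ ℕ ] Σ[ t₂ ∈ ℕ ] (
    NumSpanningTrees (delete G e) t₁ ×
    NumSpanningTrees (contract G e (proj₁ s e)) t₂ ×
    t₂ ≢ 0 ×
    (+ t₁ ℚ./ 1) ≡ (+ t₂ ℚ./ 1) ℚ.* sumℚ q ×
    Σ[ cf ∈ ((i : Fin k) → ℕ × List ℕ) ] (
    (∀ i → IsCF (lookup q i) (cf i)) ×
    length G ≡ 4 * sumℕ (tabulate (λ i → cfSum (cf i))) + 1)))

  conclude : ∀ {k} (q : Vec ℚ k) cf p → (∀ i → IsCF (lookup q i) (cf i)) → Conducts p (sumℚ q) →
    size p ≡ 4 * sumℕ (tabulate (cfSum ∘ cf)) → Realised (trees p) (forests p) (size p) → Conclusion q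
  conclude q cf p isCF conducts size≡ record
    { order = suc n ; s = s ; t = t ; H = H ; pos = pos ; drawing = drawing ; nps = nps@(np ∷ _)
    ; deleted = deleted ; contracted = contracted ; length-H = length-H } =
    n , (s , t) ∷ H , isSimple , (pos , planeDrawing drawing) , zero , trees p , forests p ,
    count⇒numSpanningTrees deleted ,
    subst (λ K → NumSpanningTrees K (forests p)) (sym (contract-first s≢t (LAll.tail (Drawing.loopless drawing)) np))
      (count⇒numSpanningTrees (Equivalence.to (count-contract (merge-contracts s≢t) H) contracted)) ,
    (λ eq → ℕₚ.<-irrefl (sym eq) (forests>0 p)) ,
    conducts , cf , isCF ,
    trans (cong suc (trans length-H size≡)) (ℕₚ.+-comm 1 _)
    where
    isSimple = simple drawing nps
    s≢t = proj₁ isSimple zero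

  conclusion : ∀ {k} (q : Vec ℚ (suc k)) → All Positive q → Conclusion q
  conclusion q q>0 =
    let cf , p , isCF , conducts , size≡ = realise-sum q q>0
    in conclude q cf p isCF conducts size≡ (realised p)

open import Data.Nat as ℕ using (ℕ; suc; _≤_; _*_; _+_)
open import Data.Integer using (+_)
open import Data.Rational as ℚ using (ℚ; Positive)
open import Data.Fin using (Fin)
open import Data.Vec as Vec using (Vec; lookup; tabulate)
open import Data.Vec.Relation.Unary.All using (All)
open import Data.List using (List; length)
open import Data.Product using (Σ-syntax; _×_; proj₁)
open import Relation.Binary.PropositionalEquality using (_≡_; _≢_)
open Assembly using (conclusion)

theorem1p5 : (k : ℕ) → 1 ≤ k → (q : Vec ℚ k) → All Positive q →
    Σ[ n ∈ ℕ ] Σ[ G ∈ Graph (suc n) ] Σ[ s ∈ Simple G ] (Planar G ×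
    Σ[ e ∈ Edge G ] Σ[ t₁ ∈ ℕ ] Σ[ t₂ ∈ ℕ ] (
    NumSpanningTrees (delete G e) t₁ ×
    NumSpanningTrees (contract G e (proj₁ s e)) t₂ ×
    t₂ ≢ 0 ×
    (+ t₁ ℚ./ 1) ≡ (+ t₂ ℚ./ 1) ℚ.* sumℚ q ×
    Σ[ cf ∈ ((i : Fin k) → ℕ × List ℕ) ] (
    (∀ i → IsCF (lookup q i) (cf i)) ×
    length G ≡ 4 * sumℕ (tabulate (λ i → cfSum (cf i))) + 1)))
theorem1p5 (suc k) _ q q>0 = conclusion q q>0
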